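{- For all complex $q$ with $|q|<1$, $$F^{\rm ed}_{\rm od}(q)=\frac{q\,(-q^2;q^2)_\infty}{1-q}\left(2-\frac{(-q;q^2)_\infty}{(-q^2;q^2)_\infty}\right).$$
   Context: For $n\in\mathbb N_0\cup\{\infty\}$, $(a;q)_n:=\prod_{j=0}^{n-1}(1-aq^j)$. Define $$F^{\rm ed}_{\rm od}(q):=\sum_{n=0}^\infty q^{2n+1}(-q;q^2)_n(-q^{2n+2};q^2)_\infty,$$ the generating function for partitions into at least one odd part, with odd parts distinct, and even parts distinct and all larger than every odd part. -}

module Defs where

open import Algebra.Bundles.Raw using (RawRing)
import Algebra.Definitions
import Algebra.Definitions.RawSemiring
open import Data.Fin.Base using (toℕ)
open import Data.Nat.Base as ℕ using (ℕ)
import Data.Nat.Properties as ℕ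
open import Data.Product.Base using (∃; ∃-syntax; _×_; _,_)
open import Data.Rational.Base as ℚ using (ℚ; 0ℚ; 1ℚ; ½)
import Data.Rational.Properties as ℚ
open import Level using (0ℓ)
open import Relation.Binary.PropositionalEquality.Core
  using (_≡_; refl; sym; trans; cong; subst)
open import Relation.Nullary.Decidable.Core using (dec⇒maybe)
open import Tactic.RingSolver using (solve-∀)
open import Tactic.RingSolver.Core.AlmostCommutativeRing
  using (AlmostCommutativeRing; fromCommutativeRing)

------------------------------------------------------------------------
-- Real numbers: Cauchy sequences of rationals, considered up to _≈ᴿ_.

IsCauchy : (ℕ → ℚ) → Set
IsCauchy x = ∀ {ε} → 0ℚ ℚ.< ε →
  ∃[ N ] (∀ {m n} → N ℕ.≤ m → N ℕ.≤ n → ℚ.∣ x m ℚ.- x n ∣ ℚ.< ε)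

-- Without eta, comparing reals never compares their Cauchy proofs.
record ℝ : Set where
  no-eta-equality
  constructor mkℝ
  field
    seq    : ℕ → ℚ
    cauchy : IsCauchy seq

open ℝ public

infix 4 _≈ᴿ_ _<ᴿ_

record _≈ᴿ_ (x y : ℝ) : Set where
  constructor mk≈ᴿ
  field
    close : ∀ {ε} → 0ℚ ℚ.< ε →
      ∃[ N ] (∀ {n} → N ℕ.≤ n → ℚ.∣ seq x n ℚ.- seq y n ∣ ℚ.< ε)

-- The rational gap δ is essential: termwise seq x n < seq y n would also
-- hold for some pairs of equal reals.
record _<ᴿ_ (x y : ℝ) : Set where
  constructor mk<
  field
    {δ}  : ℚ
    0<δ  : 0ℚ ℚ.< δ
    from : ℕ
    gap  : ∀ {n} → from ℕ.≤ n → seq x n ℚ.+ δ ℚ.≤ seq y n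

private
  ℚ-ring : AlmostCommutativeRing 0ℓ 0ℓ
  ℚ-ring = fromCommutativeRing ℚ.+-*-commutativeRing (λ p → dec⇒maybe (0ℚ ℚ.≟ p))

  halve : ∀ {ε} → 0ℚ ℚ.< ε → 0ℚ ℚ.< ½ ℚ.* ε
  halve {ε} 0<ε = ℚ.positive⁻¹ _ {{ℚ.pos*pos⇒pos ½ ε {{ℚ.positive 0<ε}}}}

  halves : ∀ ε → ½ ℚ.* ε ℚ.+ ½ ℚ.* ε ≡ ε
  halves ε = trans (sym (ℚ.*-distribʳ-+ ε ½ ½)) (ℚ.*-identityˡ ε)

  +-cauchy : ∀ {x y} → IsCauchy x → IsCauchy y →
             IsCauchy (λ n → x n ℚ.+ y n)
  +-cauchy {x} {y} cx cy {ε} 0<ε =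
    let M , p = cx (halve {ε} 0<ε)
        N , q = cy (halve {ε} 0<ε)
    in M ℕ.⊔ N , λ {m} {n} hm hn → begin-strict
      ℚ.∣ (x m ℚ.+ y m) ℚ.- (x n ℚ.+ y n) ∣
        ≡⟨ cong ℚ.∣_∣ (rearrange (x m) (y m) (x n) (y n)) ⟩
      ℚ.∣ (x m ℚ.- x n) ℚ.+ (y m ℚ.- y n) ∣
        ≤⟨ ℚ.∣p+q∣≤∣p∣+∣q∣ (x m ℚ.- x n) (y m ℚ.- y n) ⟩
      ℚ.∣ x m ℚ.- x n ∣ ℚ.+ ℚ.∣ y m ℚ.- y n ∣
        <⟨ ℚ.+-mono-< (p (ℕ.m⊔n≤o⇒m≤o M N hm) (ℕ.m⊔n≤o⇒m≤o M N hn))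
                      (q (ℕ.m⊔n≤o⇒n≤o M N hm) (ℕ.m⊔n≤o⇒n≤o M N hn)) ⟩
      ½ ℚ.* ε ℚ.+ ½ ℚ.* ε
        ≡⟨ halves ε ⟩
      ε ∎
    where
    open ℚ.≤-Reasoning
    rearrange : ∀ a b c d →
      (a ℚ.+ b) ℚ.- (c ℚ.+ d) ≡ (a ℚ.- c) ℚ.+ (b ℚ.- d)
    rearrange = solve-∀ ℚ-ring

  neg-cauchy : ∀ {x} → IsCauchy x → IsCauchy (λ n → ℚ.- x n)
  neg-cauchy {x} cx {ε} 0<ε = let N , p = cx 0<ε in N , λ {m} {n} hm hn →
    subst (ℚ._< ε)
      (trans (sym (ℚ.∣-p∣≡∣p∣ (x m ℚ.- x n)))
             (cong ℚ.∣_∣ (ℚ.neg-distrib-+ (x m) (ℚ.- x n))))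
      (p hm hn)

  bound : ∀ {x} → IsCauchy x →
    ∃[ K ] 0ℚ ℚ.< K × ∃[ N ] (∀ {n} → N ℕ.≤ n → ℚ.∣ x n ∣ ℚ.≤ K)
  bound {x} cx =
    let N , p = cx (ℚ.positive⁻¹ 1ℚ)
    in 1ℚ ℚ.+ ℚ.∣ x N ∣
    , ℚ.+-mono-<-≤ (ℚ.positive⁻¹ 1ℚ) (ℚ.0≤∣p∣ (x N))
    , N , λ {n} h → begin
      ℚ.∣ x n ∣                      ≡⟨ cong ℚ.∣_∣ (split (x n) (x N)) ⟩
      ℚ.∣ (x n ℚ.- x N) ℚ.+ x N ∣    ≤⟨ ℚ.∣p+q∣≤∣p∣+∣q∣ (x n ℚ.- x N) (x N) ⟩
      ℚ.∣ x n ℚ.- x N ∣ ℚ.+ ℚ.∣ x N ∣ ≤⟨ ℚ.+-monoˡ-≤ ℚ.∣ x N ∣ (ℚ.<⇒≤ (p h ℕ.≤-refl)) ⟩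
      1ℚ ℚ.+ ℚ.∣ x N ∣               ∎
    where
    open ℚ.≤-Reasoning
    split : ∀ a b → a ≡ (a ℚ.- b) ℚ.+ b
    split = solve-∀ ℚ-ring

  divide : ∀ J {ε} → 0ℚ ℚ.< J → 0ℚ ℚ.< ε → ∃[ δ ] 0ℚ ℚ.< δ × J ℚ.* δ ≡ ε
  divide J {ε} 0<J 0<ε
    = 1/J ℚ.* ε
    , ℚ.positive⁻¹ (1/J ℚ.* ε)
        {{ℚ.pos*pos⇒pos 1/J {{ℚ.1/pos⇒pos J {{J+}}}} ε {{ℚ.positive 0<ε}}}}
    , trans (sym (ℚ.*-assoc J 1/J ε))
        (trans (cong (ℚ._* ε) (ℚ.*-inverseʳ J {{J≢0}})) (ℚ.*-identityˡ ε))
    where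
    J+ : ℚ.Positive J
    J+ = ℚ.positive 0<J
    J≢0 : ℚ.NonZero J
    J≢0 = ℚ.pos⇒nonZero J {{J+}}
    1/J : ℚ
    1/J = (ℚ.1/ J) {{J≢0}}

  *-bound : ∀ {J δ} s t → 0ℚ ℚ.< J →
    ℚ.∣ s ∣ ℚ.≤ J → ℚ.∣ t ∣ ℚ.< δ → ℚ.∣ s ℚ.* t ∣ ℚ.< J ℚ.* δ
  *-bound {J} {δ} s t 0<J s≤J t<δ = begin-strict
    ℚ.∣ s ℚ.* t ∣       ≡⟨ ℚ.∣p*q∣≡∣p∣*∣q∣ s t ⟩
    ℚ.∣ s ∣ ℚ.* ℚ.∣ t ∣ ≤⟨ ℚ.*-monoʳ-≤-nonNeg ℚ.∣ t ∣ {{ℚ.∣-∣-nonNeg t}} s≤J ⟩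
    J ℚ.* ℚ.∣ t ∣       <⟨ ℚ.*-monoʳ-<-pos J {{ℚ.positive 0<J}} t<δ ⟩
    J ℚ.* δ             ∎
    where open ℚ.≤-Reasoning

  -- |st - uv| ≤ |s||t - v| + |v||s - u| < Kδ + Lδ = ε
  *-close : ∀ {K L δ ε} s t u v → 0ℚ ℚ.< K → 0ℚ ℚ.< L → (K ℚ.+ L) ℚ.* δ ≡ ε →
    ℚ.∣ s ∣ ℚ.≤ K → ℚ.∣ v ∣ ℚ.≤ L →
    ℚ.∣ s ℚ.- u ∣ ℚ.< δ → ℚ.∣ t ℚ.- v ∣ ℚ.< δ →
    ℚ.∣ s ℚ.* t ℚ.- u ℚ.* v ∣ ℚ.< ε
  *-close {K} {L} {δ} {ε} s t u v 0<K 0<L total s≤K v≤L s-u<δ t-v<δ =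
    begin-strict
    ℚ.∣ s ℚ.* t ℚ.- u ℚ.* v ∣
      ≡⟨ cong ℚ.∣_∣ (rearrange s t u v) ⟩
    ℚ.∣ s ℚ.* (t ℚ.- v) ℚ.+ v ℚ.* (s ℚ.- u) ∣
      ≤⟨ ℚ.∣p+q∣≤∣p∣+∣q∣ (s ℚ.* (t ℚ.- v)) (v ℚ.* (s ℚ.- u)) ⟩
    ℚ.∣ s ℚ.* (t ℚ.- v) ∣ ℚ.+ ℚ.∣ v ℚ.* (s ℚ.- u) ∣
      <⟨ ℚ.+-mono-< (*-bound s (t ℚ.- v) 0<K s≤K t-v<δ)
                    (*-bound v (s ℚ.- u) 0<L v≤L s-u<δ) ⟩
    K ℚ.* δ ℚ.+ L ℚ.* δ
      ≡⟨ sym (ℚ.*-distribʳ-+ δ K L) ⟩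
    (K ℚ.+ L) ℚ.* δ
      ≡⟨ total ⟩
    ε ∎
    where
    open ℚ.≤-Reasoning
    rearrange : ∀ s t u v →
      s ℚ.* t ℚ.- u ℚ.* v ≡ s ℚ.* (t ℚ.- v) ℚ.+ v ℚ.* (s ℚ.- u)
    rearrange = solve-∀ ℚ-ring

  *-cauchy : ∀ {x y} → IsCauchy x → IsCauchy y →
             IsCauchy (λ n → x n ℚ.* y n)
  *-cauchy {x} {y} cx cy {ε} 0<ε =
    let K , 0<K , A , a = bound {x} cx
        L , 0<L , B , b = bound {y} cy
        δ , 0<δ , total = divide (K ℚ.+ L) {ε} (ℚ.+-mono-< 0<K 0<L) 0<ε
        C , c = cx 0<δ
        D , d = cy 0<δ
    in (A ℕ.⊔ B) ℕ.⊔ (C ℕ.⊔ D) , λ {m} {n} hm hn →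
      let ABm = ℕ.m⊔n≤o⇒m≤o (A ℕ.⊔ B) (C ℕ.⊔ D) hm
          ABn = ℕ.m⊔n≤o⇒m≤o (A ℕ.⊔ B) (C ℕ.⊔ D) hn
          CDm = ℕ.m⊔n≤o⇒n≤o (A ℕ.⊔ B) (C ℕ.⊔ D) hm
          CDn = ℕ.m⊔n≤o⇒n≤o (A ℕ.⊔ B) (C ℕ.⊔ D) hn
      in *-close {K} {L} {δ} {ε} (x m) (y m) (x n) (y n) 0<K 0<L total
        (a {m} (ℕ.m⊔n≤o⇒m≤o A B ABm)) (b {n} (ℕ.m⊔n≤o⇒n≤o A B ABn))
        (c {m} {n} (ℕ.m⊔n≤o⇒m≤o C D CDm) (ℕ.m⊔n≤o⇒m≤o C D CDn))
        (d {m} {n} (ℕ.m⊔n≤o⇒n≤o C D CDm) (ℕ.m⊔n≤o⇒n≤o C D CDn))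

infix  8 -ᴿ_
infixl 7 _*ᴿ_
infixl 6 _+ᴿ_

fromℚ : ℚ → ℝ
seq    (fromℚ p) _ = p
cauchy (fromℚ p) {ε} 0<ε =
  0 , λ _ _ → subst (ℚ._< ε) (cong ℚ.∣_∣ (sym (ℚ.+-inverseʳ p))) 0<ε

_+ᴿ_ : ℝ → ℝ → ℝ
seq    (x +ᴿ y) n = seq x n ℚ.+ seq y n
cauchy (x +ᴿ y)   = +-cauchy {seq x} {seq y} (cauchy x) (cauchy y)

_*ᴿ_ : ℝ → ℝ → ℝ
seq    (x *ᴿ y) n = seq x n ℚ.* seq y n
cauchy (x *ᴿ y)   = *-cauchy {seq x} {seq y} (cauchy x) (cauchy y)

-ᴿ_ : ℝ → ℝ
seq    (-ᴿ x) n = ℚ.- seq x n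
cauchy (-ᴿ x)   = neg-cauchy {seq x} (cauchy x)

------------------------------------------------------------------------
-- Complex numbers

record ℂ : Set where
  no-eta-equality
  constructor _+i_
  field
    re : ℝ
    im : ℝ

open ℂ public

infix 4 _≈_

record _≈_ (z w : ℂ) : Set where
  constructor mk≈
  field
    re≈ : re z ≈ᴿ re w
    im≈ : im z ≈ᴿ im w

infix  8 -_
infixl 7 _*_
infixl 6 _+_ _-_

_+_ : ℂ → ℂ → ℂ
re (z + w) = re z +ᴿ re w
im (z + w) = im z +ᴿ im w

_*_ : ℂ → ℂ → ℂ
re (z * w) = re z *ᴿ re w +ᴿ -ᴿ (im z *ᴿ im w)
im (z * w) = re z *ᴿ im w +ᴿ im z *ᴿ re w

-_ : ℂ → ℂ
re (- z) = -ᴿ re z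
im (- z) = -ᴿ im z

_-_ : ℂ → ℂ → ℂ
z - w = z + - w

0# : ℂ
re 0# = fromℚ 0ℚ
im 0# = fromℚ 0ℚ

1# : ℂ
re 1# = fromℚ 1ℚ
im 1# = fromℚ 0ℚ

2# : ℂ
2# = 1# + 1#

ℂ-rawRing : RawRing 0ℓ 0ℓ
ℂ-rawRing = record
  { Carrier = ℂ
  ; _≈_     = _≈_
  ; _+_     = _+_
  ; _*_     = _*_
  ; -_      = -_
  ; 0#      = 0#
  ; 1#      = 1#
  }

open Algebra.Definitions.RawSemiring (RawRing.rawSemiring ℂ-rawRing) public
  using (_^_; sum; product)
open Algebra.Definitions _≈_ using (Invertible)

IsInvertible : ℂ → Set
IsInvertible = Invertible 1# _*_

infixl 7 _÷_[_]

_÷_[_] : (z w : ℂ) → IsInvertible w → ℂ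
z ÷ w [ w⁻¹ , _ ] = z * w⁻¹

∣_∣² : ℂ → ℝ
∣ z ∣² = re z *ᴿ re z +ᴿ im z *ᴿ im z

-- |z| < r, where |z| = √(re z² + im z²), with both sides squared to avoid
-- the real square root; squaring is faithful because r is positive.
infix 4 ∣_∣<_

record ∣_∣<_ (z : ℂ) (r : ℚ) : Set where
  constructor mk∣∣<
  field
    0<r : 0ℚ ℚ.< r
    sq< : ∣ z ∣² <ᴿ fromℚ (r ℚ.* r)

------------------------------------------------------------------------
-- Limits, series and q-Pochhammer symbols

infix 4 _⟶_

record _⟶_ (s : ℕ → ℂ) (l : ℂ) : Set where
  constructor mk⟶
  field
    near : ∀ {ε} → 0ℚ ℚ.< ε → ∃[ N ] (∀ {n} → N ℕ.≤ n → ∣ s n - l ∣< ε)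

-- There is no total limit operator constructively, so a limit is read off
-- from a convergence proof.  Limits are unique up to _≈_.
record Convergent (s : ℕ → ℂ) : Set where
  constructor converges
  field
    lim    : ℂ
    to-lim : s ⟶ lim

open Convergent public

Summable : (ℕ → ℂ) → Set
Summable f = Convergent (λ N → sum {N} (λ j → f (toℕ j)))

qPoch : (a q : ℂ) → ℕ → ℂ
qPoch a q n = product {n} (λ j → 1# - a * q ^ toℕ j)

QPoch∞ : (a q : ℂ) → Set
QPoch∞ a q = Convergent (qPoch a q)

Tails : ℂ → Set
Tails q = ∀ n → QPoch∞ (- (q ^ (2 ℕ.* n ℕ.+ 2))) (q ^ 2)

F-summand : (q : ℂ) → Tails q → ℕ → ℂ
F-summand q tails n =
  q ^ (2 ℕ.* n ℕ.+ 1) * qPoch (- q) (q ^ 2) n * lim (tails n)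

-- Witnesses that F(q) makes sense: every infinite product
-- (-q²ⁿ⁺²; q²)_∞ converges, and so does the series of the summands.
record FConverges (q : ℂ) : Set where
  field
    tails  : Tails q
    series : Summable (F-summand q tails)

F-ed-od : (q : ℂ) → FConverges q → ℂ
F-ed-od q c = lim (FConverges.series c)

-- Witnesses that the closed form makes sense: both infinite products
-- converge and both denominators are invertible.
record ClosedFormDefined (q : ℂ) : Set where
  field
    -q⨾q²∞       : QPoch∞ (- q) (q ^ 2)
    -q²⨾q²∞      : QPoch∞ (- (q ^ 2)) (q ^ 2)
    1-q-inv      : IsInvertible (1# - q)
    -q²⨾q²∞-inv  : IsInvertible (lim -q²⨾q²∞)

closedForm : (q : ℂ) → ClosedFormDefined q → ℂ
closedForm q d =
  q * B ÷ (1# - q) [ 1-q-inv ] * (2# - A ÷ B [ -q²⨾q²∞-inv ])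
  where
  open ClosedFormDefined d
  A B : ℂ
  A = lim -q⨾q²∞
  B = lim -q²⨾q²∞

{-# OPTIONS --safe #-}

-- Write Pₙ = (-q;q²)ₙ, Tₙ = (-q²ⁿ⁺²;q²)_∞, uₙ = Pₙ Tₙ and let fₙ = q²ⁿ⁺¹ uₙ be the
-- summand.  Since Pₙ₊₁ = (1 + q²ⁿ⁺¹) Pₙ and Tₙ = (1 + q²ⁿ⁺²) Tₙ₊₁, one finds
-- q fₙ = q (uₙ₊₁ - uₙ) + fₙ₊₁.  Summing, the partial sums satisfy
-- Sₙ₊₁ = q Sₙ + 2q T₀ - q uₙ, and in the limit (1 - q) F = q (2 T₀ - P_∞).
-- Every limit comes from completeness, by geometric bounds on consecutive
-- differences.  An infinite product (a;Q)_∞ is first reduced to (aQⁿ;Q)_∞ with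
-- aQⁿ small, where it is close to 1; this gives its convergence and, for
-- |a| < 1, its invertibility.

module Submission where

open import Defs
open import Data.Product.Base using (_×_)
open import Data.Rational.Base using (1ℚ)

open import Algebra.Bundles using (CommutativeRing; Monoid)
import Algebra.Definitions.RawMonoid
import Algebra.Definitions.RawSemiring
import Algebra.Properties.Monoid.Sum
import Algebra.Properties.Semiring.Exp
import Algebra.Solver.Ring
import Algebra.Solver.Ring.AlmostCommutativeRing as Solver
open import Algebra.Structures _≈_ using (IsCommutativeRing)
open import Data.Fin.Base using (toℕ)
open import Data.Integer.Base as ℤ using (+_)
import Data.Integer.Properties as ℤ
open import Data.Maybe.Base as Maybe using (Maybe)
open import Data.Nat.Base as ℕ using (ℕ; zero; suc)
import Data.Nat.Coprimality as Coprimality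
import Data.Nat.Properties as ℕ
open import Data.Product.Base using (∃-syntax; _,_; proj₁; proj₂)
open import Data.Rational.Base as ℚ using (ℚ; mkℚ; 0ℚ; ½)
import Data.Rational.Properties as ℚ
import Data.Rational.Unnormalised.Base as ℚᵘ
import Data.Rational.Unnormalised.Properties as ℚᵘ
open import Data.Sum.Base using (inj₁; inj₂)
open import Function.Base using (_∘_)
open import Level using (0ℓ)
open import Relation.Binary.PropositionalEquality
  using (_≡_; refl; sym; trans; cong; cong₂; subst; subst₂)
import Relation.Binary.Reasoning.Setoid
open import Relation.Nullary.Decidable using (dec⇒maybe)
open import Tactic.RingSolver using (solve-∀)
open import Tactic.RingSolver.Core.AlmostCommutativeRing
  using (AlmostCommutativeRing; fromCommutativeRing)

open Algebra.Definitions.RawSemiring ℚ.+-*-rawSemiring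
  using () renaming (_^_ to _^ℚ_)
open ∣_∣<_

-- With x = q²ⁿ, the sequence u exchanges the even factor 1 + q²x for the odd factor 1 + qx, so uₙ₊₁
-- - uₙ = qx(1 - q) Pₙ Tₙ₊₁. In q fₙ - fₙ₊₁ = q²x Pₙ Tₙ₊₁ ((1 + q²x) - q(1 + qx)) the terms in q²x
-- cancel and leave the same factor 1 - q; this is the whole algebraic content. The rest is shaped
-- by constructivity. A limit is part of a convergence witness, and the equality is claimed for
-- every pair of witnesses, so it is derived for arbitrary limits that are compared only through
-- uniqueness; completeness serves the existence claims alone. An inverse has to be exhibited as
-- well. Both denominators get theirs from the geometric series: 1 - q directly, and the product as
-- finitely many factors 1 - a with |a| < 1 times a number at distance less than 1 from 1. Finally,
-- each bound |z| < r carries a rational gap, which pays for a change of representative and supplies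
-- a rational ratio below 1.

ℚ-ring : AlmostCommutativeRing 0ℓ 0ℓ
ℚ-ring = fromCommutativeRing ℚ.+-*-commutativeRing (λ p → dec⇒maybe (0ℚ ℚ.≟ p))

-- Rational estimates

≤-by : ∀ {p q} d → 0ℚ ℚ.≤ d → p ℚ.+ d ≡ q → p ℚ.≤ q
≤-by {p} d 0≤d refl = subst (ℚ._≤ p ℚ.+ d) (ℚ.+-identityʳ p) (ℚ.+-monoʳ-≤ p 0≤d)

<-by : ∀ {p q} d → 0ℚ ℚ.< d → p ℚ.+ d ≡ q → p ℚ.< q
<-by {p} d 0<d refl = subst (ℚ._< p ℚ.+ d) (ℚ.+-identityʳ p) (ℚ.+-monoʳ-< p 0<d)

+-pos : ∀ {p q} → 0ℚ ℚ.< p → 0ℚ ℚ.< q → 0ℚ ℚ.< p ℚ.+ q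
+-pos 0<p 0<q = ℚ.+-mono-< 0<p 0<q

*-pos : ∀ {p q} → 0ℚ ℚ.< p → 0ℚ ℚ.< q → 0ℚ ℚ.< p ℚ.* q
*-pos {p} {q} 0<p 0<q =
  ℚ.positive⁻¹ _ {{ℚ.pos*pos⇒pos p {{ℚ.positive 0<p}} q {{ℚ.positive 0<q}}}}

*-nonNeg : ∀ {p q} → 0ℚ ℚ.≤ p → 0ℚ ℚ.≤ q → 0ℚ ℚ.≤ p ℚ.* q
*-nonNeg {p} {q} 0≤p 0≤q = ℚ.nonNegative⁻¹ _
  {{ℚ.nonNeg*nonNeg⇒nonNeg p {{ℚ.nonNegative 0≤p}} q {{ℚ.nonNegative 0≤q}}}}

*-monoˡ-≤ : ∀ {p q} r → 0ℚ ℚ.≤ r → p ℚ.≤ q → r ℚ.* p ℚ.≤ r ℚ.* q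
*-monoˡ-≤ r 0≤r = ℚ.*-monoˡ-≤-nonNeg r {{ℚ.nonNegative 0≤r}}

*-monoʳ-≤ : ∀ {p q} r → 0ℚ ℚ.≤ r → p ℚ.≤ q → p ℚ.* r ℚ.≤ q ℚ.* r
*-monoʳ-≤ r 0≤r = ℚ.*-monoʳ-≤-nonNeg r {{ℚ.nonNegative 0≤r}}

∣p∣²≡p² : ∀ p → ℚ.∣ p ∣ ℚ.* ℚ.∣ p ∣ ≡ p ℚ.* p
∣p∣²≡p² p with ℚ.∣p∣≡p∨∣p∣≡-p p
... | inj₁ eq = cong (λ a → a ℚ.* a) eq
... | inj₂ eq = trans (cong (λ a → a ℚ.* a) eq) (neg-sq p)
  where
  neg-sq : ∀ p → (ℚ.- p) ℚ.* (ℚ.- p) ≡ p ℚ.* p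
  neg-sq = solve-∀ ℚ-ring

0≤p² : ∀ p → 0ℚ ℚ.≤ p ℚ.* p
0≤p² p = subst (0ℚ ℚ.≤_) (∣p∣²≡p² p) (*-nonNeg (ℚ.0≤∣p∣ p) (ℚ.0≤∣p∣ p))

sq-mono-≤ : ∀ {p q} → 0ℚ ℚ.≤ p → p ℚ.≤ q → p ℚ.* p ℚ.≤ q ℚ.* q
sq-mono-≤ {p} {q} 0≤p p≤q =
  ℚ.≤-trans (*-monoˡ-≤ p 0≤p p≤q) (*-monoʳ-≤ q (ℚ.≤-trans 0≤p p≤q) p≤q)

sq-cancel-< : ∀ {p q} → 0ℚ ℚ.≤ q → p ℚ.* p ℚ.< q ℚ.* q → p ℚ.< q
sq-cancel-< {p} {q} 0≤q p²<q² = ℚ.≰⇒> λ q≤p →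
  ℚ.<-irrefl refl (ℚ.<-≤-trans p²<q² (sq-mono-≤ 0≤q q≤p))

halve : ∀ {ε} → 0ℚ ℚ.< ε → ∃[ δ ] 0ℚ ℚ.< δ × δ ℚ.+ δ ≡ ε
halve {ε} 0<ε = ½ ℚ.* ε , *-pos (ℚ.positive⁻¹ ½) 0<ε
  , trans (sym (ℚ.*-distribʳ-+ ε ½ ½)) (ℚ.*-identityˡ ε)

divide : ∀ {J ε} → 0ℚ ℚ.< J → 0ℚ ℚ.< ε → ∃[ δ ] 0ℚ ℚ.< δ × J ℚ.* δ ≡ ε
divide {J} {ε} 0<J 0<ε
  = 1/J ℚ.* ε
  , *-pos (ℚ.positive⁻¹ 1/J {{ℚ.1/pos⇒pos J {{J+}}}}) 0<ε
  , trans (sym (ℚ.*-assoc J 1/J ε))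
      (trans (cong (ℚ._* ε) (ℚ.*-inverseʳ J {{J≢0}})) (ℚ.*-identityˡ ε))
  where
  J+ : ℚ.Positive J
  J+ = ℚ.positive 0<J
  J≢0 : ℚ.NonZero J
  J≢0 = ℚ.pos⇒nonZero J {{J+}}
  1/J : ℚ
  1/J = (ℚ.1/ J) {{J≢0}}

-- The Archimedean property and geometric decay

fromℕ : ℕ → ℚ
fromℕ zero    = 0ℚ
fromℕ (suc n) = 1ℚ ℚ.+ fromℕ n

-- The recursive form of `fromℕ` suits inductions such as `bernoulli`; the normal form exposes the
-- numerator for the comparison in `p≤fromℕ`.
fromℕ≡mkℚ : ∀ n → fromℕ n ≡ mkℚ (+ n) 0 (Coprimality.sym (Coprimality.1-coprimeTo n))
fromℕ≡mkℚ zero    = refl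
fromℕ≡mkℚ (suc n) = ℚ.toℚᵘ-injective (ℚᵘ.≃-trans
  (ℚ.toℚᵘ-homo-+ 1ℚ (fromℕ n))
  (ℚᵘ.≃-trans
    (ℚᵘ.≃-reflexive (cong (λ p → ℚ.toℚᵘ 1ℚ ℚᵘ.+ ℚ.toℚᵘ p) (fromℕ≡mkℚ n)))
    (ℚᵘ.*≡* (cong (λ k → k ℤ.* ℤ.1ℤ) (cong (λ k → ℤ.1ℤ ℤ.+ k) (ℤ.*-identityʳ (+ n)))))))

p≤fromℕ : ∀ p → ∃[ n ] p ℚ.≤ fromℕ n
-- The absolute value of the numerator is large enough, because the denominator is at least 1.
p≤fromℕ p@(mkℚ a d-1 _) = ℤ.∣ a ∣ , subst (p ℚ.≤_) (sym (fromℕ≡mkℚ ℤ.∣ a ∣))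
  (ℚ.*≤* (ℤ.≤-trans (ℤ.≤-reflexive (ℤ.*-identityʳ a))
    (ℤ.≤-trans (i≤+∣i∣ a) (subst (ℤ._≤ + ℤ.∣ a ∣ ℤ.* + suc d-1)
       (ℤ.*-identityʳ (+ ℤ.∣ a ∣)) (ℤ.*-monoˡ-≤-nonNeg (+ ℤ.∣ a ∣) (ℤ.+≤+ (ℕ.s≤s ℕ.z≤n)))))))
  where
  i≤+∣i∣ : ∀ i → i ℤ.≤ + ℤ.∣ i ∣
  i≤+∣i∣ (+ n)      = ℤ.≤-refl
  i≤+∣i∣ ℤ.-[1+ n ] = ℤ.-≤+

archimedean : ∀ p {q} → 0ℚ ℚ.< q → ∃[ n ] p ℚ.≤ fromℕ n ℚ.* q
archimedean p {q} 0<q =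
  let 1/q , 0<1/q , q*1/q≡1 = divide 0<q (ℚ.positive⁻¹ 1ℚ)
      n , p/q≤n = p≤fromℕ (p ℚ.* 1/q)
  in n , subst (ℚ._≤ fromℕ n ℚ.* q)
       (trans (swap p 1/q q) (trans (cong (p ℚ.*_) q*1/q≡1) (ℚ.*-identityʳ p)))
       (*-monoʳ-≤ q (ℚ.<⇒≤ 0<q) p/q≤n)
  where
  swap : ∀ a b c → (a ℚ.* b) ℚ.* c ≡ a ℚ.* (c ℚ.* b)
  swap = solve-∀ ℚ-ring

0≤fromℕ : ∀ n → 0ℚ ℚ.≤ fromℕ n
0≤fromℕ zero    = ℚ.≤-refl
0≤fromℕ (suc n) = ℚ.+-mono-≤ (ℚ.nonNegative⁻¹ 1ℚ) (0≤fromℕ n)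

fromℕ-mono : ∀ {m n} → m ℕ.≤ n → fromℕ m ℚ.≤ fromℕ n
fromℕ-mono {n = n} ℕ.z≤n = 0≤fromℕ n
fromℕ-mono (ℕ.s≤s m≤n)   = ℚ.+-monoʳ-≤ 1ℚ (fromℕ-mono m≤n)

^ℚ-nonNeg : ∀ {ρ} → 0ℚ ℚ.≤ ρ → ∀ n → 0ℚ ℚ.≤ ρ ^ℚ n
^ℚ-nonNeg 0≤ρ zero    = ℚ.nonNegative⁻¹ 1ℚ
^ℚ-nonNeg 0≤ρ (suc n) = *-nonNeg 0≤ρ (^ℚ-nonNeg 0≤ρ n)

^ℚ-pos : ∀ {ρ} → 0ℚ ℚ.< ρ → ∀ n → 0ℚ ℚ.< ρ ^ℚ n
^ℚ-pos 0<ρ zero    = ℚ.positive⁻¹ 1ℚ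
^ℚ-pos 0<ρ (suc n) = *-pos 0<ρ (^ℚ-pos 0<ρ n)

-- A division-free form of Bernoulli's inequality. The left-hand side does not increase with n: from
-- n to n + 1 it drops by (n + 1)(1 - ρ)²ρⁿ.
bernoulli : ∀ {ρ} → 0ℚ ℚ.≤ ρ →
  ∀ n → ρ ^ℚ n ℚ.* (1ℚ ℚ.+ fromℕ n ℚ.* (1ℚ ℚ.- ρ)) ℚ.≤ 1ℚ
bernoulli {ρ} 0≤ρ zero = ℚ.≤-reflexive (base ρ)
  where
  base : ∀ r → 1ℚ ℚ.* (1ℚ ℚ.+ 0ℚ ℚ.* (1ℚ ℚ.- r)) ≡ 1ℚ
  base = solve-∀ ℚ-ring
bernoulli {ρ} 0≤ρ (suc n) = ℚ.≤-trans
  (≤-by (fromℕ (suc n) ℚ.* (η ℚ.* η) ℚ.* ρ ^ℚ n)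
        (*-nonNeg (*-nonNeg (0≤fromℕ (suc n)) (0≤p² η)) (^ℚ-nonNeg 0≤ρ n))
        (identity ρ (ρ ^ℚ n) (fromℕ n)))
  (bernoulli 0≤ρ n)
  where
  η : ℚ
  η = 1ℚ ℚ.- ρ
  identity : ∀ r t n →
    r ℚ.* t ℚ.* (1ℚ ℚ.+ (1ℚ ℚ.+ n) ℚ.* (1ℚ ℚ.- r))
      ℚ.+ (1ℚ ℚ.+ n) ℚ.* ((1ℚ ℚ.- r) ℚ.* (1ℚ ℚ.- r)) ℚ.* t
    ≡ t ℚ.* (1ℚ ℚ.+ n ℚ.* (1ℚ ℚ.- r))
  identity = solve-∀ ℚ-ring

p<q⇒0<q-p : ∀ {p q} → p ℚ.< q → 0ℚ ℚ.< q ℚ.- p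
p<q⇒0<q-p {p} {q} p<q = subst (ℚ._< q ℚ.- p) (ℚ.+-inverseʳ p) (ℚ.+-monoˡ-< (ℚ.- p) p<q)

geometric-decay : ∀ {ρ} C {ε} → 0ℚ ℚ.< ρ → ρ ℚ.< 1ℚ → 0ℚ ℚ.< C → 0ℚ ℚ.< ε →
  ∃[ N ] (∀ {n} → N ℕ.≤ n → C ℚ.* ρ ^ℚ n ℚ.< ε)
geometric-decay {ρ} C {ε} 0<ρ ρ<1 0<C 0<ε = N , λ {n} N≤n →
  let d : ℚ
      d = 1ℚ ℚ.+ fromℕ n ℚ.* η
      0<d : 0ℚ ℚ.< d
      0<d = ℚ.+-mono-<-≤ (ℚ.positive⁻¹ 1ℚ) (*-nonNeg (0≤fromℕ n) (ℚ.<⇒≤ 0<η))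
  -- Multiplication by d = 1 + nη brings the left side down to C by `bernoulli`, while dε exceeds
  -- nηε, which is at least C once n ≥ N.
  in ℚ.*-cancelˡ-<-nonNeg d {{ℚ.nonNegative (ℚ.<⇒≤ 0<d)}} (begin-strict
    d ℚ.* (C ℚ.* ρ ^ℚ n)           ≡⟨ rearrange d C (ρ ^ℚ n) ⟩
    C ℚ.* (ρ ^ℚ n ℚ.* d)           ≤⟨ *-monoˡ-≤ C (ℚ.<⇒≤ 0<C) (bernoulli (ℚ.<⇒≤ 0<ρ) n) ⟩
    C ℚ.* 1ℚ                       ≡⟨ ℚ.*-identityʳ C ⟩
    C                              ≤⟨ C≤Nηε ⟩
    fromℕ N ℚ.* (η ℚ.* ε)          ≤⟨ *-monoʳ-≤ (η ℚ.* ε) (ℚ.<⇒≤ 0<ηε) (fromℕ-mono N≤n) ⟩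
    fromℕ n ℚ.* (η ℚ.* ε)          <⟨ <-by ε 0<ε (expand (fromℕ n) η ε) ⟩
    d ℚ.* ε                        ∎)
  where
  open ℚ.≤-Reasoning
  η : ℚ
  η = 1ℚ ℚ.- ρ
  0<η : 0ℚ ℚ.< η
  0<η = p<q⇒0<q-p ρ<1
  0<ηε : 0ℚ ℚ.< η ℚ.* ε
  0<ηε = *-pos 0<η 0<ε
  N : ℕ
  N = proj₁ (archimedean C 0<ηε)
  C≤Nηε : C ℚ.≤ fromℕ N ℚ.* (η ℚ.* ε)
  C≤Nηε = proj₂ (archimedean C 0<ηε)
  rearrange : ∀ d c t → d ℚ.* (c ℚ.* t) ≡ c ℚ.* (t ℚ.* d)
  rearrange = solve-∀ ℚ-ring
  expand : ∀ n h e → n ℚ.* (h ℚ.* e) ℚ.+ e ≡ (1ℚ ℚ.+ n ℚ.* h) ℚ.* e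
  expand = solve-∀ ℚ-ring

-- The commutative ring ℂ

∣p-r∣<δ+ε : ∀ p q r {δ ε} → ℚ.∣ p ℚ.- q ∣ ℚ.< δ → ℚ.∣ q ℚ.- r ∣ ℚ.< ε →
  ℚ.∣ p ℚ.- r ∣ ℚ.< δ ℚ.+ ε
∣p-r∣<δ+ε p q r pq qr = ℚ.≤-<-trans
  (subst (ℚ._≤ ℚ.∣ p ℚ.- q ∣ ℚ.+ ℚ.∣ q ℚ.- r ∣) (cong ℚ.∣_∣ (telescope p q r))
    (ℚ.∣p+q∣≤∣p∣+∣q∣ (p ℚ.- q) (q ℚ.- r)))
  (ℚ.+-mono-< pq qr)
  where
  telescope : ∀ a b c → (a ℚ.- b) ℚ.+ (b ℚ.- c) ≡ a ℚ.- c
  telescope = solve-∀ ℚ-ring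

∣p-q∣≡∣q-p∣ : ∀ p q → ℚ.∣ p ℚ.- q ∣ ≡ ℚ.∣ q ℚ.- p ∣
∣p-q∣≡∣q-p∣ p q = trans (sym (ℚ.∣-p∣≡∣p∣ (p ℚ.- q))) (cong ℚ.∣_∣ (flip p q))
  where
  flip : ∀ a b → ℚ.- (a ℚ.- b) ≡ b ℚ.- a
  flip = solve-∀ ℚ-ring

-- The condition of `_≈ᴿ_` at a single tolerance, so that different tolerances can be chained.
Close : ℝ → ℝ → ℚ → Set
Close x y ε = ∃[ N ] (∀ {n} → N ℕ.≤ n → ℚ.∣ seq x n ℚ.- seq y n ∣ ℚ.< ε)

Close-sym : ∀ {x y ε} → Close x y ε → Close y x ε
Close-sym {x} {y} {ε} (N , p) =
  N , λ {n} h → subst (ℚ._< ε) (∣p-q∣≡∣q-p∣ (seq x n) (seq y n)) (p h)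

Close-trans : ∀ {x y z δ ε} → Close x y δ → Close y z ε → Close x z (δ ℚ.+ ε)
Close-trans {x} {y} {z} (M , p) (N , q) = M ℕ.⊔ N , λ {n} h →
  ∣p-r∣<δ+ε (seq x n) (seq y n) (seq z n) (p (ℕ.m⊔n≤o⇒m≤o M N h)) (q (ℕ.m⊔n≤o⇒n≤o M N h))

pointwise : ∀ {x y} → (∀ n → seq x n ≡ seq y n) → x ≈ᴿ y
pointwise {x} {y} eq = mk≈ᴿ λ {ε} 0<ε → 0 , λ {n} _ →
  subst (ℚ._< ε)
    (cong ℚ.∣_∣ (sym (trans (cong (ℚ._- seq y n) (eq n)) (ℚ.+-inverseʳ (seq y n)))))
    0<ε

≈ᴿ-sym : ∀ {x y} → x ≈ᴿ y → y ≈ᴿ x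
≈ᴿ-sym {x} {y} (mk≈ᴿ close) = mk≈ᴿ λ 0<ε → Close-sym {x} {y} (close 0<ε)

≈ᴿ-trans : ∀ {x y z} → x ≈ᴿ y → y ≈ᴿ z → x ≈ᴿ z
≈ᴿ-trans {x} {y} {z} (mk≈ᴿ xy) (mk≈ᴿ yz) = mk≈ᴿ λ 0<ε →
  let δ , 0<δ , δ+δ≡ε = halve 0<ε
  in subst (Close x z) δ+δ≡ε (Close-trans {x} {y} {z} (xy 0<δ) (yz 0<δ))

+ᴿ-cong : ∀ {x y u v} → x ≈ᴿ y → u ≈ᴿ v → x +ᴿ u ≈ᴿ y +ᴿ v
+ᴿ-cong {x} {y} {u} {v} (mk≈ᴿ xy) (mk≈ᴿ uv) = mk≈ᴿ λ {ε} 0<ε →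
  let δ , 0<δ , δ+δ≡ε = halve 0<ε
      M , p = xy 0<δ
      N , q = uv 0<δ
  in M ℕ.⊔ N , λ {n} h → ℚ.≤-<-trans
    (subst (ℚ._≤ ℚ.∣ seq x n ℚ.- seq y n ∣ ℚ.+ ℚ.∣ seq u n ℚ.- seq v n ∣)
      (cong ℚ.∣_∣ (rearrange (seq x n) (seq y n) (seq u n) (seq v n)))
      (ℚ.∣p+q∣≤∣p∣+∣q∣ (seq x n ℚ.- seq y n) (seq u n ℚ.- seq v n)))
    (subst (ℚ.∣ seq x n ℚ.- seq y n ∣ ℚ.+ ℚ.∣ seq u n ℚ.- seq v n ∣ ℚ.<_) δ+δ≡ε
      (ℚ.+-mono-< (p (ℕ.m⊔n≤o⇒m≤o M N h)) (q (ℕ.m⊔n≤o⇒n≤o M N h))))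
  where
  rearrange : ∀ a b c d → (a ℚ.- b) ℚ.+ (c ℚ.- d) ≡ (a ℚ.+ c) ℚ.- (b ℚ.+ d)
  rearrange = solve-∀ ℚ-ring

-ᴿ-cong : ∀ {x y} → x ≈ᴿ y → -ᴿ x ≈ᴿ -ᴿ y
-ᴿ-cong {x} {y} (mk≈ᴿ xy) = mk≈ᴿ λ {ε} 0<ε → let N , p = xy 0<ε in N , λ {n} h →
  subst (ℚ._< ε)
    (trans (∣p-q∣≡∣q-p∣ (seq x n) (seq y n)) (cong ℚ.∣_∣ (flip (seq x n) (seq y n))))
    (p h)
  where
  flip : ∀ a b → b ℚ.- a ≡ ℚ.- a ℚ.- (ℚ.- b)
  flip = solve-∀ ℚ-ring

bounded : ∀ x → ∃[ K ] 0ℚ ℚ.< K × ∃[ N ] (∀ {n} → N ℕ.≤ n → ℚ.∣ seq x n ∣ ℚ.≤ K)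
bounded x =
  let N , p = cauchy x (ℚ.positive⁻¹ 1ℚ)
      K = 1ℚ ℚ.+ ℚ.∣ seq x N ∣
  in K , ℚ.+-mono-<-≤ (ℚ.positive⁻¹ 1ℚ) (ℚ.0≤∣p∣ (seq x N)) , N , λ {n} h →
    ℚ.≤-trans
      (subst (λ a → ℚ.∣ a ∣ ℚ.≤ ℚ.∣ seq x n ℚ.- seq x N ∣ ℚ.+ ℚ.∣ seq x N ∣)
        (restore (seq x n) (seq x N)) (ℚ.∣p+q∣≤∣p∣+∣q∣ (seq x n ℚ.- seq x N) (seq x N)))
      (ℚ.+-monoˡ-≤ ℚ.∣ seq x N ∣ (ℚ.<⇒≤ (p h ℕ.≤-refl)))
  where
  restore : ∀ a b → (a ℚ.- b) ℚ.+ b ≡ a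
  restore = solve-∀ ℚ-ring

*ᴿ-congˡ : ∀ z {x y} → x ≈ᴿ y → z *ᴿ x ≈ᴿ z *ᴿ y
*ᴿ-congˡ z {x} {y} (mk≈ᴿ xy) = mk≈ᴿ λ {ε} 0<ε →
  let K , 0<K , M , b = bounded z
      δ , 0<δ , Kδ≡ε  = divide 0<K 0<ε
      N , p = xy 0<δ
  in M ℕ.⊔ N , λ {n} h → subst₂ ℚ._<_
    (trans (sym (ℚ.∣p*q∣≡∣p∣*∣q∣ (seq z n) _)) (cong ℚ.∣_∣ (expand (seq z n) (seq x n) (seq y n))))
    Kδ≡ε
    (ℚ.≤-<-trans
      (*-monoʳ-≤ _ (ℚ.0≤∣p∣ _) (b (ℕ.m⊔n≤o⇒m≤o M N h)))
      (ℚ.*-monoʳ-<-pos K {{ℚ.positive 0<K}} (p (ℕ.m⊔n≤o⇒n≤o M N h))))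
  where
  expand : ∀ c a b → c ℚ.* (a ℚ.- b) ≡ c ℚ.* a ℚ.- c ℚ.* b
  expand = solve-∀ ℚ-ring

*ᴿ-cong : ∀ {x y u v} → x ≈ᴿ y → u ≈ᴿ v → x *ᴿ u ≈ᴿ y *ᴿ v
*ᴿ-cong {x} {y} {u} {v} x≈y u≈v = ≈ᴿ-trans
  (*ᴿ-congˡ x u≈v)
  (≈ᴿ-trans (comm x v) (≈ᴿ-trans (*ᴿ-congˡ v x≈y) (comm v y)))
  where
  comm : ∀ x y → x *ᴿ y ≈ᴿ y *ᴿ x
  comm x y = pointwise λ n → ℚ.*-comm (seq x n) (seq y n)

≈-refl : ∀ {z} → z ≈ z
≈-refl = mk≈ (pointwise λ _ → refl) (pointwise λ _ → refl)

≈-sym : ∀ {z w} → z ≈ w → w ≈ z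
≈-sym (mk≈ p q) = mk≈ (≈ᴿ-sym p) (≈ᴿ-sym q)

≈-trans : ∀ {z w v} → z ≈ w → w ≈ v → z ≈ v
≈-trans (mk≈ p q) (mk≈ r s) = mk≈ (≈ᴿ-trans p r) (≈ᴿ-trans q s)

-- The operations act termwise on representatives, so each axiom is a rational identity at every
-- index; only the congruences need estimates.
isCommutativeRing : IsCommutativeRing _+_ _*_ -_ 0# 1#
isCommutativeRing = record
  { isRing = record
    { +-isAbelianGroup = record
      { isGroup = record
        { isMonoid = record
          { isSemigroup = record
            { isMagma = record
              { isEquivalence = record { refl = ≈-refl ; sym = ≈-sym ; trans = ≈-trans }
              ; ∙-cong = λ { (mk≈ p q) (mk≈ r s) → mk≈ (+ᴿ-cong p r) (+ᴿ-cong q s) }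
              }
            ; assoc = λ z w v → mk≈
                (pointwise λ n → ℚ.+-assoc (seq (re z) n) (seq (re w) n) (seq (re v) n))
                (pointwise λ n → ℚ.+-assoc (seq (im z) n) (seq (im w) n) (seq (im v) n))
            }
          ; identity =
              (λ z → mk≈ (pointwise λ n → ℚ.+-identityˡ (seq (re z) n))
                         (pointwise λ n → ℚ.+-identityˡ (seq (im z) n)))
            , (λ z → mk≈ (pointwise λ n → ℚ.+-identityʳ (seq (re z) n))
                         (pointwise λ n → ℚ.+-identityʳ (seq (im z) n)))
          }
        ; inverse =
            (λ z → mk≈ (pointwise λ n → ℚ.+-inverseˡ (seq (re z) n))
                       (pointwise λ n → ℚ.+-inverseˡ (seq (im z) n)))
          , (λ z → mk≈ (pointwise λ n → ℚ.+-inverseʳ (seq (re z) n))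
                       (pointwise λ n → ℚ.+-inverseʳ (seq (im z) n)))
        ; ⁻¹-cong = λ { (mk≈ p q) → mk≈ (-ᴿ-cong p) (-ᴿ-cong q) }
        }
      ; comm = λ z w → mk≈
          (pointwise λ n → ℚ.+-comm (seq (re z) n) (seq (re w) n))
          (pointwise λ n → ℚ.+-comm (seq (im z) n) (seq (im w) n))
      }
    ; *-cong = λ { (mk≈ p q) (mk≈ r s) → mk≈
        (+ᴿ-cong (*ᴿ-cong p r) (-ᴿ-cong (*ᴿ-cong q s)))
        (+ᴿ-cong (*ᴿ-cong p s) (*ᴿ-cong q r)) }
    ; *-assoc = λ z w v → mk≈
        (pointwise λ n → assoc-re (seq (re z) n) (seq (im z) n)
          (seq (re w) n) (seq (im w) n) (seq (re v) n) (seq (im v) n))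
        (pointwise λ n → assoc-im (seq (re z) n) (seq (im z) n)
          (seq (re w) n) (seq (im w) n) (seq (re v) n) (seq (im v) n))
    ; *-identity =
        (λ z → mk≈ (pointwise λ n → idˡ-re (seq (re z) n) (seq (im z) n))
                   (pointwise λ n → idˡ-im (seq (re z) n) (seq (im z) n)))
      , (λ z → mk≈ (pointwise λ n → idʳ-re (seq (re z) n) (seq (im z) n))
                   (pointwise λ n → idʳ-im (seq (re z) n) (seq (im z) n)))
    ; distrib =
        (λ z w v → mk≈
          (pointwise λ n → distˡ-re (seq (re z) n) (seq (im z) n)
            (seq (re w) n) (seq (im w) n) (seq (re v) n) (seq (im v) n))
          (pointwise λ n → distˡ-im (seq (re z) n) (seq (im z) n)
            (seq (re w) n) (seq (im w) n) (seq (re v) n) (seq (im v) n)))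
      , (λ z w v → mk≈
          (pointwise λ n → distʳ-re (seq (re z) n) (seq (im z) n)
            (seq (re w) n) (seq (im w) n) (seq (re v) n) (seq (im v) n))
          (pointwise λ n → distʳ-im (seq (re z) n) (seq (im z) n)
            (seq (re w) n) (seq (im w) n) (seq (re v) n) (seq (im v) n)))
    }
  ; *-comm = λ z w → mk≈
      (pointwise λ n → comm-re (seq (re z) n) (seq (im z) n) (seq (re w) n) (seq (im w) n))
      (pointwise λ n → comm-im (seq (re z) n) (seq (im z) n) (seq (re w) n) (seq (im w) n))
  }
  where
  assoc-re : ∀ a b c d e f →
    (a ℚ.* c ℚ.- b ℚ.* d) ℚ.* e ℚ.- (a ℚ.* d ℚ.+ b ℚ.* c) ℚ.* f
    ≡ a ℚ.* (c ℚ.* e ℚ.- d ℚ.* f) ℚ.- b ℚ.* (c ℚ.* f ℚ.+ d ℚ.* e)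
  assoc-re = solve-∀ ℚ-ring
  assoc-im : ∀ a b c d e f →
    (a ℚ.* c ℚ.- b ℚ.* d) ℚ.* f ℚ.+ (a ℚ.* d ℚ.+ b ℚ.* c) ℚ.* e
    ≡ a ℚ.* (c ℚ.* f ℚ.+ d ℚ.* e) ℚ.+ b ℚ.* (c ℚ.* e ℚ.- d ℚ.* f)
  assoc-im = solve-∀ ℚ-ring
  idˡ-re : ∀ a b → 1ℚ ℚ.* a ℚ.- 0ℚ ℚ.* b ≡ a
  idˡ-re = solve-∀ ℚ-ring
  idˡ-im : ∀ a b → 1ℚ ℚ.* b ℚ.+ 0ℚ ℚ.* a ≡ b
  idˡ-im = solve-∀ ℚ-ring
  idʳ-re : ∀ a b → a ℚ.* 1ℚ ℚ.- b ℚ.* 0ℚ ≡ a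
  idʳ-re = solve-∀ ℚ-ring
  idʳ-im : ∀ a b → a ℚ.* 0ℚ ℚ.+ b ℚ.* 1ℚ ≡ b
  idʳ-im = solve-∀ ℚ-ring
  distˡ-re : ∀ a b c d e f →
    a ℚ.* (c ℚ.+ e) ℚ.- b ℚ.* (d ℚ.+ f) ≡ (a ℚ.* c ℚ.- b ℚ.* d) ℚ.+ (a ℚ.* e ℚ.- b ℚ.* f)
  distˡ-re = solve-∀ ℚ-ring
  distˡ-im : ∀ a b c d e f →
    a ℚ.* (d ℚ.+ f) ℚ.+ b ℚ.* (c ℚ.+ e) ≡ (a ℚ.* d ℚ.+ b ℚ.* c) ℚ.+ (a ℚ.* f ℚ.+ b ℚ.* e)
  distˡ-im = solve-∀ ℚ-ring
  distʳ-re : ∀ a b c d e f →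
    (c ℚ.+ e) ℚ.* a ℚ.- (d ℚ.+ f) ℚ.* b ≡ (c ℚ.* a ℚ.- d ℚ.* b) ℚ.+ (e ℚ.* a ℚ.- f ℚ.* b)
  distʳ-re = solve-∀ ℚ-ring
  distʳ-im : ∀ a b c d e f →
    (c ℚ.+ e) ℚ.* b ℚ.+ (d ℚ.+ f) ℚ.* a ≡ (c ℚ.* b ℚ.+ d ℚ.* a) ℚ.+ (e ℚ.* b ℚ.+ f ℚ.* a)
  distʳ-im = solve-∀ ℚ-ring
  comm-re : ∀ a b c d → a ℚ.* c ℚ.- b ℚ.* d ≡ c ℚ.* a ℚ.- d ℚ.* b
  comm-re = solve-∀ ℚ-ring
  comm-im : ∀ a b c d → a ℚ.* d ℚ.+ b ℚ.* c ≡ c ℚ.* b ℚ.+ d ℚ.* a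
  comm-im = solve-∀ ℚ-ring

ℂ-commutativeRing : CommutativeRing 0ℓ 0ℓ
ℂ-commutativeRing = record { isCommutativeRing = isCommutativeRing }

open CommutativeRing ℂ-commutativeRing
  using (setoid; +-cong; *-cong; -‿cong; +-monoid; *-monoid; semiring)
open Algebra.Properties.Monoid.Sum *-monoid
  using () renaming (sum-cong-≋ to product-cong)
open Algebra.Properties.Semiring.Exp semiring using (^-homo-*; ^-assocʳ)
module ≈-Reasoning = Relation.Binary.Reasoning.Setoid setoid

-- The first two clauses make the solver's constants 0ℚ and 1ℚ denote 0# and 1#
-- definitionally.
embed : ℚ → ℂ
embed (mkℚ (+ 0) 0 _) = 0#
embed (mkℚ (+ 1) 0 _) = 1#
embed p               = fromℚ p +i fromℚ 0ℚ

embed-re : ∀ p n → seq (re (embed p)) n ≡ p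
embed-re (mkℚ (+ 0) 0 _)             n = refl
embed-re (mkℚ (+ 0) (suc _) _)       n = refl
embed-re (mkℚ (+ 1) 0 _)             n = refl
embed-re (mkℚ (+ 1) (suc _) _)       n = refl
embed-re (mkℚ (+ suc (suc _)) _ _)   n = refl
embed-re (mkℚ ℤ.-[1+ _ ] _ _)        n = refl

embed-im : ∀ p n → seq (im (embed p)) n ≡ 0ℚ
embed-im (mkℚ (+ 0) 0 _)             n = refl
embed-im (mkℚ (+ 0) (suc _) _)       n = refl
embed-im (mkℚ (+ 1) 0 _)             n = refl
embed-im (mkℚ (+ 1) (suc _) _)       n = refl
embed-im (mkℚ (+ suc (suc _)) _ _)   n = refl
embed-im (mkℚ ℤ.-[1+ _ ] _ _)        n = refl

embed-homomorphism : ℚ.+-*-rawRing Solver.-Raw-AlmostCommutative⟶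
                     Solver.fromCommutativeRing ℂ-commutativeRing
embed-homomorphism = record
  { ⟦_⟧    = embed
  ; +-homo = λ p q → mk≈
      (pointwise λ n → trans (embed-re (p ℚ.+ q) n)
        (sym (cong₂ ℚ._+_ (embed-re p n) (embed-re q n))))
      (pointwise λ n → trans (embed-im (p ℚ.+ q) n)
        (sym (cong₂ ℚ._+_ (embed-im p n) (embed-im q n))))
  ; *-homo = λ p q → mk≈
      (pointwise λ n → trans (embed-re (p ℚ.* q) n) (trans (*-re p q)
        (sym (cong₂ ℚ._-_ (cong₂ ℚ._*_ (embed-re p n) (embed-re q n))
                          (cong₂ ℚ._*_ (embed-im p n) (embed-im q n))))))
      (pointwise λ n → trans (embed-im (p ℚ.* q) n) (trans (*-im p q)
        (sym (cong₂ ℚ._+_ (cong₂ ℚ._*_ (embed-re p n) (embed-im q n))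
                          (cong₂ ℚ._*_ (embed-im p n) (embed-re q n))))))
  ; -‿homo = λ p → mk≈
      (pointwise λ n → trans (embed-re (ℚ.- p) n) (sym (cong ℚ.-_ (embed-re p n))))
      (pointwise λ n → trans (embed-im (ℚ.- p) n) (sym (cong ℚ.-_ (embed-im p n))))
  ; 0-homo = ≈-refl
  ; 1-homo = ≈-refl
  }
  where
  *-re : ∀ p q → p ℚ.* q ≡ p ℚ.* q ℚ.- 0ℚ ℚ.* 0ℚ
  *-re = solve-∀ ℚ-ring
  *-im : ∀ p q → 0ℚ ≡ p ℚ.* 0ℚ ℚ.+ 0ℚ ℚ.* q
  *-im = solve-∀ ℚ-ring

-- The solver has to compare coefficients. Equality on ℂ offers no decision procedure, so the
-- coefficients are taken in ℚ and mapped in by `embed`.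
embed-≟ : ∀ p q → Maybe (embed p ≈ embed q)
embed-≟ p q = Maybe.map (λ { refl → ≈-refl }) (dec⇒maybe (p ℚ.≟ q))

module ℂ-Solver = Algebra.Solver.Ring ℚ.+-*-rawRing
  (Solver.fromCommutativeRing ℂ-commutativeRing) embed-homomorphism
  embed-≟

open ℂ-Solver

-- The modulus

-- Cauchy–Schwarz without square roots:
-- s²(a² + b²) + r²(c² + d²) - 2rs(ac + bd) is a sum of squares.
2⟨z,w⟩≤2rs : ∀ a b c d r s → 0ℚ ℚ.< r → 0ℚ ℚ.< s →
  a ℚ.* a ℚ.+ b ℚ.* b ℚ.≤ r ℚ.* r → c ℚ.* c ℚ.+ d ℚ.* d ℚ.≤ s ℚ.* s →
  (a ℚ.* c ℚ.+ b ℚ.* d) ℚ.+ (a ℚ.* c ℚ.+ b ℚ.* d) ℚ.≤ r ℚ.* s ℚ.+ r ℚ.* s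
2⟨z,w⟩≤2rs a b c d r s 0<r 0<s ab≤r cd≤s =
  ℚ.*-cancelˡ-≤-pos (r ℚ.* s) {{ℚ.positive (*-pos 0<r 0<s)}} (begin
    r ℚ.* s ℚ.* ((a ℚ.* c ℚ.+ b ℚ.* d) ℚ.+ (a ℚ.* c ℚ.+ b ℚ.* d))
      ≤⟨ ≤-by _ (ℚ.+-mono-≤ (0≤p² (s ℚ.* a ℚ.- r ℚ.* c)) (0≤p² (s ℚ.* b ℚ.- r ℚ.* d)))
              (square a b c d r s) ⟩
    s ℚ.* s ℚ.* (a ℚ.* a ℚ.+ b ℚ.* b) ℚ.+ r ℚ.* r ℚ.* (c ℚ.* c ℚ.+ d ℚ.* d)
      ≤⟨ ℚ.+-mono-≤ (*-monoˡ-≤ (s ℚ.* s) (0≤p² s) ab≤r) (*-monoˡ-≤ (r ℚ.* r) (0≤p² r) cd≤s) ⟩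
    s ℚ.* s ℚ.* (r ℚ.* r) ℚ.+ r ℚ.* r ℚ.* (s ℚ.* s)
      ≡⟨ factor r s ⟩
    r ℚ.* s ℚ.* (r ℚ.* s ℚ.+ r ℚ.* s) ∎)
  where
  open ℚ.≤-Reasoning
  square : ∀ a b c d r s →
    r ℚ.* s ℚ.* ((a ℚ.* c ℚ.+ b ℚ.* d) ℚ.+ (a ℚ.* c ℚ.+ b ℚ.* d))
      ℚ.+ ((s ℚ.* a ℚ.- r ℚ.* c) ℚ.* (s ℚ.* a ℚ.- r ℚ.* c)
           ℚ.+ (s ℚ.* b ℚ.- r ℚ.* d) ℚ.* (s ℚ.* b ℚ.- r ℚ.* d))
    ≡ s ℚ.* s ℚ.* (a ℚ.* a ℚ.+ b ℚ.* b) ℚ.+ r ℚ.* r ℚ.* (c ℚ.* c ℚ.+ d ℚ.* d)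
  square = solve-∀ ℚ-ring
  factor : ∀ r s → s ℚ.* s ℚ.* (r ℚ.* r) ℚ.+ r ℚ.* r ℚ.* (s ℚ.* s)
                   ≡ r ℚ.* s ℚ.* (r ℚ.* s ℚ.+ r ℚ.* s)
  factor = solve-∀ ℚ-ring

≤-dropʳ : ∀ {p q δ} → 0ℚ ℚ.< δ → p ℚ.+ δ ℚ.≤ q → p ℚ.≤ q
≤-dropʳ {p} {δ = δ} 0<δ = ℚ.≤-trans (≤-by δ (ℚ.<⇒≤ 0<δ) refl)

norm-+ : ∀ {z w r s} → ∣ z ∣< r → ∣ w ∣< s → ∣ z + w ∣< r ℚ.+ s
norm-+ {z} {w} {r} {s} (mk∣∣< 0<r (mk< {δ} 0<δ M p)) (mk∣∣< 0<s (mk< {ε} 0<ε N q)) =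
  mk∣∣< (+-pos 0<r 0<s) (mk< (+-pos 0<δ 0<ε) (M ℕ.⊔ N) λ {n} h →
    let a = seq (re z) n
        b = seq (im z) n
        c = seq (re w) n
        d = seq (im w) n
        p′ = p (ℕ.m⊔n≤o⇒m≤o M N h)
        q′ = q (ℕ.m⊔n≤o⇒n≤o M N h)
    in subst₂ ℚ._≤_ (lhs a b c d δ ε) (rhs r s)
      (ℚ.+-mono-≤ (ℚ.+-mono-≤ p′ q′)
        (2⟨z,w⟩≤2rs a b c d r s 0<r 0<s (≤-dropʳ 0<δ p′) (≤-dropʳ 0<ε q′))))
  where
  lhs : ∀ a b c d δ ε →
    ((a ℚ.* a ℚ.+ b ℚ.* b ℚ.+ δ) ℚ.+ (c ℚ.* c ℚ.+ d ℚ.* d ℚ.+ ε))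
      ℚ.+ ((a ℚ.* c ℚ.+ b ℚ.* d) ℚ.+ (a ℚ.* c ℚ.+ b ℚ.* d))
    ≡ (a ℚ.+ c) ℚ.* (a ℚ.+ c) ℚ.+ (b ℚ.+ d) ℚ.* (b ℚ.+ d) ℚ.+ (δ ℚ.+ ε)
  lhs = solve-∀ ℚ-ring
  rhs : ∀ r s → (r ℚ.* r ℚ.+ s ℚ.* s) ℚ.+ (r ℚ.* s ℚ.+ r ℚ.* s) ≡ (r ℚ.+ s) ℚ.* (r ℚ.+ s)
  rhs = solve-∀ ℚ-ring

norm-* : ∀ {z w r s} → ∣ z ∣< r → ∣ w ∣< s → ∣ z * w ∣< r ℚ.* s
norm-* {z} {w} {r} {s} (mk∣∣< 0<r (mk< {δ} 0<δ M p)) (mk∣∣< 0<s (mk< {ε} 0<ε N q)) =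
  -- The gap δs² is that of z scaled by s²; from w only |w|² ≤ s² enters.
  mk∣∣< (*-pos 0<r 0<s) (mk< (*-pos 0<δ (*-pos 0<s 0<s)) (M ℕ.⊔ N) λ {n} h →
    let a = seq (re z) n
        b = seq (im z) n
        c = seq (re w) n
        d = seq (im w) n
        z² = a ℚ.* a ℚ.+ b ℚ.* b
        w² = c ℚ.* c ℚ.+ d ℚ.* d
    in begin
      _                                              ≡⟨ multiplicative a b c d _ ⟩
      z² ℚ.* w² ℚ.+ δ ℚ.* (s ℚ.* s)
        ≤⟨ ℚ.+-monoˡ-≤ (δ ℚ.* (s ℚ.* s)) (*-monoˡ-≤ z² (ℚ.+-mono-≤ (0≤p² a) (0≤p² b))
             (≤-dropʳ {w²} 0<ε (q (ℕ.m⊔n≤o⇒n≤o M N h)))) ⟩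
      z² ℚ.* (s ℚ.* s) ℚ.+ δ ℚ.* (s ℚ.* s)           ≡⟨ ℚ.*-distribʳ-+ (s ℚ.* s) z² δ ⟨
      (z² ℚ.+ δ) ℚ.* (s ℚ.* s)
        ≤⟨ *-monoʳ-≤ (s ℚ.* s) (0≤p² s) (p (ℕ.m⊔n≤o⇒m≤o M N h)) ⟩
      r ℚ.* r ℚ.* (s ℚ.* s)                          ≡⟨ square r s ⟩
      r ℚ.* s ℚ.* (r ℚ.* s)                          ∎)
  where
  open ℚ.≤-Reasoning
  multiplicative : ∀ a b c d ε →
    (a ℚ.* c ℚ.- b ℚ.* d) ℚ.* (a ℚ.* c ℚ.- b ℚ.* d)
      ℚ.+ (a ℚ.* d ℚ.+ b ℚ.* c) ℚ.* (a ℚ.* d ℚ.+ b ℚ.* c) ℚ.+ ε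
    ≡ (a ℚ.* a ℚ.+ b ℚ.* b) ℚ.* (c ℚ.* c ℚ.+ d ℚ.* d) ℚ.+ ε
  multiplicative = solve-∀ ℚ-ring
  square : ∀ r s → r ℚ.* r ℚ.* (s ℚ.* s) ≡ r ℚ.* s ℚ.* (r ℚ.* s)
  square = solve-∀ ℚ-ring

norm-mono : ∀ {z r s} → r ℚ.≤ s → ∣ z ∣< r → ∣ z ∣< s
norm-mono r≤s (mk∣∣< 0<r (mk< 0<δ N p)) = mk∣∣< (ℚ.<-≤-trans 0<r r≤s)
  (mk< 0<δ N λ h → ℚ.≤-trans (p h) (sq-mono-≤ (ℚ.<⇒≤ 0<r) r≤s))

-- With 2rη = δ one has r² - δ + η² = (r - η)², and η < r since δ ≤ r².
norm-shrink : ∀ {z r} → ∣ z ∣< r → ∃[ η ] 0ℚ ℚ.< η × ∣ z ∣< r ℚ.- η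
norm-shrink {z} {r} (mk∣∣< 0<r (mk< {δ} 0<δ N p)) = η , 0<η , mk∣∣<
  (p<q⇒0<q-p η<r) (mk< (*-pos 0<η 0<η) N λ {n} h →
    subst₂ ℚ._≤_ (lhs (seq ∣ z ∣² n) δ (η ℚ.* η)) (rhs r η)
      (ℚ.+-monoˡ-≤ (η ℚ.* η ℚ.- (r ℚ.+ r) ℚ.* η)
        (subst (λ d → seq ∣ z ∣² n ℚ.+ d ℚ.≤ r ℚ.* r) (sym 2rη≡δ) (p h)) ))
  where
  quotient = divide (+-pos 0<r 0<r) 0<δ
  η : ℚ
  η = proj₁ quotient
  0<η : 0ℚ ℚ.< η
  0<η = proj₁ (proj₂ quotient)
  2rη≡δ : (r ℚ.+ r) ℚ.* η ≡ δ
  2rη≡δ = proj₂ (proj₂ quotient)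
  lhs : ∀ N δ e → (N ℚ.+ (r ℚ.+ r) ℚ.* η) ℚ.+ (e ℚ.- (r ℚ.+ r) ℚ.* η) ≡ N ℚ.+ e
  lhs N δ e = cancel N ((r ℚ.+ r) ℚ.* η) e
    where
    cancel : ∀ a b c → (a ℚ.+ b) ℚ.+ (c ℚ.- b) ≡ a ℚ.+ c
    cancel = solve-∀ ℚ-ring
  rhs : ∀ r η → r ℚ.* r ℚ.+ (η ℚ.* η ℚ.- (r ℚ.+ r) ℚ.* η) ≡ (r ℚ.- η) ℚ.* (r ℚ.- η)
  rhs = solve-∀ ℚ-ring
  regroup : ∀ r η → (r ℚ.+ r) ℚ.* η ≡ r ℚ.* (η ℚ.+ η)
  regroup = solve-∀ ℚ-ring
  2η≤r : η ℚ.+ η ℚ.≤ r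
  2η≤r = ℚ.*-cancelˡ-≤-pos r {{ℚ.positive 0<r}} (begin
    r ℚ.* (η ℚ.+ η)      ≡⟨ regroup r η ⟨
    (r ℚ.+ r) ℚ.* η      ≡⟨ 2rη≡δ ⟩
    δ                    ≤⟨ ≤-by (seq ∣ z ∣² N)
                                (ℚ.+-mono-≤ (0≤p² (seq (re z) N)) (0≤p² (seq (im z) N)))
                                (ℚ.+-comm δ _) ⟩
    seq ∣ z ∣² N ℚ.+ δ   ≤⟨ p ℕ.≤-refl ⟩
    r ℚ.* r              ∎)
    where open ℚ.≤-Reasoning
  η<r : η ℚ.< r
  η<r = ℚ.<-≤-trans (<-by η 0<η refl) 2η≤r

-- |a|, |b| < δ gives a² + b² ≤ 2δ² = (2δ)² - 2δ².
Close⇒norm : ∀ {z w δ} → 0ℚ ℚ.< δ → Close (re z) (re w) δ → Close (im z) (im w) δ →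
  ∣ z - w ∣< δ ℚ.+ δ
Close⇒norm {z} {w} {δ} 0<δ (M , p) (N , q) = mk∣∣< (+-pos 0<δ 0<δ)
  (mk< (+-pos (*-pos 0<δ 0<δ) (*-pos 0<δ 0<δ)) (M ℕ.⊔ N) λ {n} h →
    subst (seq ∣ z - w ∣² n ℚ.+ (δ ℚ.* δ ℚ.+ δ ℚ.* δ) ℚ.≤_) (total δ)
      (ℚ.+-monoˡ-≤ _ (ℚ.+-mono-≤
        (below (seq (re z) n ℚ.- seq (re w) n) (p (ℕ.m⊔n≤o⇒m≤o M N h)))
        (below (seq (im z) n ℚ.- seq (im w) n) (q (ℕ.m⊔n≤o⇒n≤o M N h))))))
  where
  below : ∀ a → ℚ.∣ a ∣ ℚ.< δ → a ℚ.* a ℚ.≤ δ ℚ.* δ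
  below a a<δ = subst (ℚ._≤ δ ℚ.* δ) (∣p∣²≡p² a) (sq-mono-≤ (ℚ.0≤∣p∣ a) (ℚ.<⇒≤ a<δ))
  total : ∀ d → (d ℚ.* d ℚ.+ d ℚ.* d) ℚ.+ (d ℚ.* d ℚ.+ d ℚ.* d) ≡ (d ℚ.+ d) ℚ.* (d ℚ.+ d)
  total = solve-∀ ℚ-ring

norm⇒Close : ∀ {z w ε} → ∣ z - w ∣< ε → Close (re z) (re w) ε × Close (im z) (im w) ε
norm⇒Close {z} {w} {ε} (mk∣∣< 0<ε (mk< {δ} 0<δ N p)) =
    (N , λ {n} h → below (x n) (0≤p² (y n)) (p h))
  , (N , λ {n} h → below (y n) (0≤p² (x n))
      (subst (λ s → s ℚ.+ δ ℚ.≤ ε ℚ.* ε) (ℚ.+-comm (x n ℚ.* x n) (y n ℚ.* y n)) (p h)))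
  where
  x y : ℕ → ℚ
  x n = seq (re z) n ℚ.- seq (re w) n
  y n = seq (im z) n ℚ.- seq (im w) n
  below : ∀ a {b} → 0ℚ ℚ.≤ b → a ℚ.* a ℚ.+ b ℚ.+ δ ℚ.≤ ε ℚ.* ε → ℚ.∣ a ∣ ℚ.< ε
  below a {b} 0≤b bound = sq-cancel-< (ℚ.<⇒≤ 0<ε)
    (subst (ℚ._< ε ℚ.* ε) (sym (∣p∣²≡p² a))
      (ℚ.≤-<-trans (≤-by b 0≤b refl) (ℚ.<-≤-trans (<-by δ 0<δ refl) bound)))

≈⇒norm : ∀ {z w} → z ≈ w → ∀ {ε} → 0ℚ ℚ.< ε → ∣ z - w ∣< ε
≈⇒norm {z} {w} (mk≈ (mk≈ᴿ p) (mk≈ᴿ q)) 0<ε =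
  let δ , 0<δ , δ+δ≡ε = halve 0<ε
  in subst (∣ z - w ∣<_) δ+δ≡ε (Close⇒norm 0<δ (p 0<δ) (q 0<δ))

norm⇒≈ : ∀ {z w} → (∀ {ε} → 0ℚ ℚ.< ε → ∣ z - w ∣< ε) → z ≈ w
norm⇒≈ {z} {w} p = mk≈ (mk≈ᴿ λ 0<ε → proj₁ (norm⇒Close {z} {w} (p 0<ε)))
                       (mk≈ᴿ λ 0<ε → proj₂ (norm⇒Close {z} {w} (p 0<ε)))

-- The bound speaks about representatives, so its invariance needs an argument: the gap lets r
-- shrink to r - η, and the triangle inequality with |w - z| < η restores r.
norm-cong : ∀ {z w r} → z ≈ w → ∣ z ∣< r → ∣ w ∣< r
norm-cong {z} {w} {r} z≈w z<r =
  let η , 0<η , z<r-η = norm-shrink z<r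
      mk∣∣< 0<s (mk< 0<δ N p) = norm-+ z<r-η (≈⇒norm (≈-sym z≈w) 0<η)
  in subst (∣ w ∣<_) (restore′ r η) (mk∣∣< 0<s (mk< 0<δ N λ {n} h →
      subst₂ (λ a b → a ℚ.* a ℚ.+ b ℚ.* b ℚ.+ _ ℚ.≤ _)
        (restore (seq (re z) n) (seq (re w) n)) (restore (seq (im z) n) (seq (im w) n)) (p h)))
  where
  restore : ∀ a b → a ℚ.+ (b ℚ.- a) ≡ b
  restore = solve-∀ ℚ-ring
  restore′ : ∀ a b → (a ℚ.- b) ℚ.+ b ≡ a
  restore′ = solve-∀ ℚ-ring

norm-neg : ∀ {z r} → ∣ z ∣< r → ∣ - z ∣< r
norm-neg {z} {r} (mk∣∣< 0<r (mk< 0<δ N p)) = mk∣∣< 0<r (mk< 0<δ N λ {n} h →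
  subst (λ a → a ℚ.+ _ ℚ.≤ r ℚ.* r) (even (seq (re z) n) (seq (im z) n)) (p h))
  where
  even : ∀ a b → a ℚ.* a ℚ.+ b ℚ.* b ≡ (ℚ.- a) ℚ.* (ℚ.- a) ℚ.+ (ℚ.- b) ℚ.* (ℚ.- b)
  even = solve-∀ ℚ-ring

norm-bounded : ∀ z → ∃[ K ] ∣ z ∣< K
norm-bounded z =
  let K , 0<K , M , p = bounded (re z)
      L , 0<L , N , q = bounded (im z)
      0<KL = *-pos 0<K 0<L
  -- The gap is the cross term 2KL of (K + L)².
  in K ℚ.+ L , mk∣∣< (+-pos 0<K 0<L) (mk< (+-pos 0<KL 0<KL) (M ℕ.⊔ N) λ {n} h →
    subst (seq ∣ z ∣² n ℚ.+ (K ℚ.* L ℚ.+ K ℚ.* L) ℚ.≤_) (square K L)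
      (ℚ.+-monoˡ-≤ _ (ℚ.+-mono-≤
        (below (seq (re z) n) (p (ℕ.m⊔n≤o⇒m≤o M N h)))
        (below (seq (im z) n) (q (ℕ.m⊔n≤o⇒n≤o M N h))))))
  where
  below : ∀ {J} a → ℚ.∣ a ∣ ℚ.≤ J → a ℚ.* a ℚ.≤ J ℚ.* J
  below {J} a a≤J = subst (ℚ._≤ J ℚ.* J) (∣p∣²≡p² a) (sq-mono-≤ (ℚ.0≤∣p∣ a) a≤J)
  square : ∀ k l → (k ℚ.* k ℚ.+ l ℚ.* l) ℚ.+ (k ℚ.* l ℚ.+ k ℚ.* l) ≡ (k ℚ.+ l) ℚ.* (k ℚ.+ l)
  square = solve-∀ ℚ-ring

-- Completeness and limits

Close-fromℚ : ∀ {p q ε} → Close (fromℚ p) (fromℚ q) ε → ℚ.∣ p ℚ.- q ∣ ℚ.< ε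
Close-fromℚ (N , p) = p ℕ.≤-refl

-- The limit is the diagonal sequence n ↦ s_{N n} at index M n, where N n is the
-- Cauchy index of s for ½ⁿ, and M n that of the real s_{N n}.
ℝ-complete : (s : ℕ → ℝ) →
  (∀ {ε} → 0ℚ ℚ.< ε → ∃[ N ] (∀ {n} → N ℕ.≤ n → Close (s n) (s N) ε)) →
  ∃[ l ] (∀ {ε} → 0ℚ ℚ.< ε → ∃[ N ] (∀ {n} → N ℕ.≤ n → Close (s n) l ε))
ℝ-complete s s-cauchy = limit , s⟶limit
  where
  tol : ℕ → ℚ
  tol k = ½ ^ℚ k
  0<½ : 0ℚ ℚ.< ½
  0<½ = ℚ.positive⁻¹ ½
  0<tol : ∀ k → 0ℚ ℚ.< tol k
  0<tol = ^ℚ-pos 0<½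

  tol→0 : ∀ {ε} → 0ℚ ℚ.< ε → ∃[ K ] (∀ {k} → K ℕ.≤ k → tol k ℚ.< ε)
  tol→0 {ε} 0<ε =
    let K , p = geometric-decay 1ℚ 0<½ ½<1 (ℚ.positive⁻¹ 1ℚ) 0<ε
    in K , λ {k} K≤k → subst (ℚ._< ε) (ℚ.*-identityˡ (tol k)) (p K≤k)
    where
    ½<1 : ½ ℚ.< 1ℚ
    ½<1 = <-by ½ 0<½ refl

  N M : ℕ → ℕ
  N k = proj₁ (s-cauchy (0<tol k))
  M k = proj₁ (cauchy (s (N k)) (0<tol k))
  diag : ℕ → ℚ
  diag k = seq (s (N k)) (M k)

  -- One `tol k` pays for passing from `s n` to `s (N k)`, the other for freezing that real at its
  -- index `M k`.
  s-diag : ∀ k {n} → N k ℕ.≤ n → Close (s n) (fromℚ (diag k)) (tol k ℚ.+ tol k)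
  s-diag k {n} N≤n = Close-trans {s n} {s (N k)} {fromℚ (diag k)}
    (proj₂ (s-cauchy (0<tol k)) N≤n)
    (M k , λ M≤m → proj₂ (cauchy (s (N k)) (0<tol k)) M≤m ℕ.≤-refl)

  diag-cauchy : IsCauchy diag
  diag-cauchy {ε} 0<ε =
    let δ , 0<δ , δ+δ≡ε = halve 0<ε
        η , 0<η , η+η≡δ = halve 0<δ
        K , p = tol→0 0<η
        twice : ∀ {k} → K ℕ.≤ k → tol k ℚ.+ tol k ℚ.< δ
        twice {k} K≤k = subst (tol k ℚ.+ tol k ℚ.<_) η+η≡δ (ℚ.+-mono-< (p K≤k) (p K≤k))
    -- Two diagonal entries are compared through a real `s n` whose n lies past both Cauchy indices.
    in K , λ {j} {k} K≤j K≤k → ℚ.<-trans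
      (Close-fromℚ {diag j} {diag k}
        (Close-trans {fromℚ (diag j)} {s (N j ℕ.⊔ N k)} {fromℚ (diag k)}
          (Close-sym {s (N j ℕ.⊔ N k)} {fromℚ (diag j)} (s-diag j (ℕ.m≤m⊔n (N j) (N k))))
          (s-diag k (ℕ.m≤n⊔m (N j) (N k)))))
      (subst (tol j ℚ.+ tol j ℚ.+ (tol k ℚ.+ tol k) ℚ.<_) δ+δ≡ε
        (ℚ.+-mono-< (twice K≤j) (twice K≤k)))

  limit : ℝ
  limit = mkℝ diag diag-cauchy

  s⟶limit : ∀ {ε} → 0ℚ ℚ.< ε → ∃[ N ] (∀ {n} → N ℕ.≤ n → Close (s n) limit ε)
  s⟶limit {ε} 0<ε =
    let δ , 0<δ , δ+δ≡ε = halve 0<ε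
        η , 0<η , η+η≡δ = halve 0<δ
        J , p = tol→0 0<η
        K , q = diag-cauchy 0<δ
        -- Being past J keeps the diagonal error 2 `tol k` below δ; being past K keeps later
        -- diagonal entries within δ of `diag k`.
        k = J ℕ.⊔ K
        A , a = s-diag k {N k} ℕ.≤-refl
    in N k , λ {n} N≤n →
      let B , b = s-diag k N≤n
      in B ℕ.⊔ K , λ {m} h → subst (ℚ.∣ seq (s n) m ℚ.- diag m ∣ ℚ.<_) δ+δ≡ε
        (∣p-r∣<δ+ε (seq (s n) m) (diag k) (diag m)
          (ℚ.<-trans (b (ℕ.m⊔n≤o⇒m≤o B K h))
            (subst (tol k ℚ.+ tol k ℚ.<_) η+η≡δ
              (ℚ.+-mono-< (p (ℕ.m≤m⊔n J K)) (p (ℕ.m≤m⊔n J K)))))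
          (q (ℕ.m≤n⊔m J K) (ℕ.m⊔n≤o⇒n≤o B K h)))

ℂ-complete : (s : ℕ → ℂ) →
  (∀ {ε} → 0ℚ ℚ.< ε → ∃[ N ] (∀ {n} → N ℕ.≤ n → ∣ s n - s N ∣< ε)) → Convergent s
ℂ-complete s s-cauchy =
  let x , x-lim = ℝ-complete (re ∘ s) λ 0<ε → let N , p = s-cauchy 0<ε in
                    N , λ {n} h → proj₁ (norm⇒Close {s n} {s N} (p h))
      y , y-lim = ℝ-complete (im ∘ s) λ 0<ε → let N , p = s-cauchy 0<ε in
                    N , λ {n} h → proj₂ (norm⇒Close {s n} {s N} (p h))
  in converges (x +i y) (mk⟶ λ {ε} 0<ε →
    let δ , 0<δ , δ+δ≡ε = halve 0<ε
        M , p = x-lim 0<δ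
        N , q = y-lim 0<δ
    in M ℕ.⊔ N , λ {n} h → subst (∣ s n - (x +i y) ∣<_) δ+δ≡ε
      (Close⇒norm 0<δ (p (ℕ.m⊔n≤o⇒m≤o M N h)) (q (ℕ.m⊔n≤o⇒n≤o M N h))))

-- Limit laws and convergence by geometric bounds

⟶-unique : ∀ {s l m} → s ⟶ l → s ⟶ m → l ≈ m
⟶-unique {s} {l} {m} (mk⟶ p) (mk⟶ q) = norm⇒≈ λ 0<ε →
  let δ , 0<δ , δ+δ≡ε = halve 0<ε
      M , p′ = p 0<δ
      N , q′ = q 0<δ
  in subst (∣ l - m ∣<_) δ+δ≡ε (norm-cong (identity (s (M ℕ.⊔ N)) l m)
       (norm-+ (norm-neg (p′ (ℕ.m≤m⊔n M N))) (q′ (ℕ.m≤n⊔m M N))))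
  where
  identity : ∀ z l m → - (z - l) + (z - m) ≈ l - m
  identity = solve 3 (λ z l m → :- (z :- l) :+ (z :- m) := l :- m) ≈-refl

⟶-cong : ∀ {s t l} → (∀ n → s n ≈ t n) → s ⟶ l → t ⟶ l
⟶-cong s≈t (mk⟶ p) = mk⟶ λ 0<ε → let N , p′ = p 0<ε in
  N , λ {n} h → norm-cong (+-cong (s≈t n) ≈-refl) (p′ h)

⟶-suc : ∀ {s l} → s ⟶ l → (s ∘ suc) ⟶ l
⟶-suc (mk⟶ p) = mk⟶ λ 0<ε → let N , p′ = p 0<ε in
  N , λ h → p′ (ℕ.m≤n⇒m≤1+n h)

⟶-unsuc : ∀ {s l} → (s ∘ suc) ⟶ l → s ⟶ l
⟶-unsuc (mk⟶ p) = mk⟶ λ 0<ε → let N , p′ = p 0<ε in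
  suc N , λ { {suc n} (ℕ.s≤s h) → p′ h }

⟶-const : ∀ z → (λ _ → z) ⟶ z
⟶-const z = mk⟶ λ 0<ε → 0 , λ _ → ≈⇒norm ≈-refl 0<ε

⟶-+ : ∀ {s t l m} → s ⟶ l → t ⟶ m → (λ n → s n + t n) ⟶ l + m
⟶-+ {s} {t} {l} {m} (mk⟶ p) (mk⟶ q) = mk⟶ λ 0<ε →
  let δ , 0<δ , δ+δ≡ε = halve 0<ε
      M , p′ = p 0<δ
      N , q′ = q 0<δ
  in M ℕ.⊔ N , λ {n} h → subst (∣ (s n + t n) - (l + m) ∣<_) δ+δ≡ε
       (norm-cong (identity (s n) (t n) l m)
         (norm-+ (p′ (ℕ.m⊔n≤o⇒m≤o M N h)) (q′ (ℕ.m⊔n≤o⇒n≤o M N h))))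
  where
  identity : ∀ z w l m → (z - l) + (w - m) ≈ (z + w) - (l + m)
  identity = solve 4 (λ z w l m → (z :- l) :+ (w :- m) := (z :+ w) :- (l :+ m)) ≈-refl

⟶-neg : ∀ {s l} → s ⟶ l → (λ n → - s n) ⟶ - l
⟶-neg {s} {l} (mk⟶ p) = mk⟶ λ 0<ε → let N , p′ = p 0<ε in
  N , λ {n} h → norm-cong (identity (s n) l) (norm-neg (p′ h))
  where
  identity : ∀ z l → - (z - l) ≈ - z - - l
  identity = solve 2 (λ z l → :- (z :- l) := :- z :- :- l) ≈-refl

⟶-bounded : ∀ {s l} → s ⟶ l → ∃[ K ] ∃[ N ] (∀ {n} → N ℕ.≤ n → ∣ s n ∣< K)
⟶-bounded {s} {l} (mk⟶ p) =
  let K , l<K = norm-bounded l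
      N , p′ = p (ℚ.positive⁻¹ 1ℚ)
  in 1ℚ ℚ.+ K , N , λ {n} h → norm-cong (identity (s n) l) (norm-+ (p′ h) l<K)
  where
  identity : ∀ z l → (z - l) + l ≈ z
  identity = solve 2 (λ z l → (z :- l) :+ l := z) ≈-refl

⟶-* : ∀ {s t l m} → s ⟶ l → t ⟶ m → (λ n → s n * t n) ⟶ l * m
⟶-* {s} {t} {l} {m} s⟶l@(mk⟶ p) (mk⟶ q) =
  let K , J , s<K = ⟶-bounded s⟶l
      L , m<L = norm-bounded m
  in mk⟶ λ {ε} 0<ε →
    -- From st - lm = s(t - m) + m(s - l), with K an eventual bound for s and L a bound for m, the
    -- error is below (K + L)δ = ε.
    let δ , 0<δ , total = divide (+-pos (0<r (s<K ℕ.≤-refl)) (0<r m<L)) 0<ε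
        M , p′ = p 0<δ
        N , q′ = q 0<δ
    in J ℕ.⊔ (M ℕ.⊔ N) , λ {n} h →
      let h′ = ℕ.m⊔n≤o⇒n≤o J (M ℕ.⊔ N) h
      in subst (∣ s n * t n - l * m ∣<_) (trans (sym (ℚ.*-distribʳ-+ δ K L)) total)
        (norm-cong (identity (s n) (t n) l m)
          (norm-+ (norm-* (s<K (ℕ.m⊔n≤o⇒m≤o J (M ℕ.⊔ N) h)) (q′ (ℕ.m⊔n≤o⇒n≤o M N h′)))
                  (norm-* m<L (p′ (ℕ.m⊔n≤o⇒m≤o M N h′)))))
  where
  identity : ∀ z w l m → z * (w - m) + m * (z - l) ≈ z * w - l * m
  identity = solve 4 (λ z w l m → z :* (w :- m) :+ m :* (z :- l) := z :* w :- l :* m) ≈-refl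

-- Strict bounds on the terms give only a weak bound on the limit, hence the slack ε; a single term
-- within ε of l suffices.
⟶-norm : ∀ {s l r ε} → s ⟶ l → (∀ n → ∣ s n ∣< r) → 0ℚ ℚ.< ε → ∣ l ∣< r ℚ.+ ε
⟶-norm {s} {l} (mk⟶ p) s<r 0<ε =
  let N , p′ = p 0<ε
  in norm-cong (identity (s N) l) (norm-+ (s<r N) (norm-neg (p′ ℕ.≤-refl)))
  where
  identity : ∀ z l → z + - (z - l) ≈ l
  identity = solve 2 (λ z l → z :+ :- (z :- l) := l) ≈-refl

geometric-convergent : ∀ {s ρ C} M → 0ℚ ℚ.< ρ → ρ ℚ.< 1ℚ → 0ℚ ℚ.< C →
  (∀ {n} → M ℕ.≤ n → ∣ s (suc n) - s n ∣< C ℚ.* ρ ^ℚ n) → Convergent s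
geometric-convergent {s} {ρ} {C} M 0<ρ ρ<1 0<C step = ℂ-complete s λ 0<ε →
  let N , small = geometric-decay D 0<ρ ρ<1 0<D 0<ε
  in M ℕ.⊔ N , λ {n} h → norm-mono
    (ℚ.<⇒≤ (small (ℕ.m≤n⊔m M N)))
    (subst (λ k → ∣ s k - s (M ℕ.⊔ N) ∣< D ℚ.* ρ ^ℚ (M ℕ.⊔ N)) (ℕ.m∸n+n≡m h)
      (drift (n ℕ.∸ (M ℕ.⊔ N)) (ℕ.m≤m⊔n M N)))
  where
  -- D = C/(1 - ρ), so that Dρⁿ is the full tail of the series of bounds Cρᵏ from k = n on. Hence
  -- `drift` is uniform in the number of steps, and `total` splits off the first term of the tail.
  quotient = divide (p<q⇒0<q-p ρ<1) 0<C
  D : ℚ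
  D = proj₁ quotient
  0<D : 0ℚ ℚ.< D
  0<D = proj₁ (proj₂ quotient)
  total : ∀ n → C ℚ.* ρ ^ℚ n ℚ.+ D ℚ.* ρ ^ℚ suc n ≡ D ℚ.* ρ ^ℚ n
  total n = trans (cong (λ c → c ℚ.* ρ ^ℚ n ℚ.+ D ℚ.* ρ ^ℚ suc n) (sym (proj₂ (proj₂ quotient))))
                  (identity ρ D (ρ ^ℚ n))
    where
    identity : ∀ r d t → (1ℚ ℚ.- r) ℚ.* d ℚ.* t ℚ.+ d ℚ.* (r ℚ.* t) ≡ d ℚ.* t
    identity = solve-∀ ℚ-ring
  telescope : ∀ z w v → (w - v) + (z - w) ≈ z - v
  telescope = solve 3 (λ z w v → (w :- v) :+ (z :- w) := z :- v) ≈-refl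
  drift : ∀ k {m} → M ℕ.≤ m → ∣ s (k ℕ.+ m) - s m ∣< D ℚ.* ρ ^ℚ m
  drift zero    {m} M≤m = ≈⇒norm ≈-refl (*-pos 0<D (^ℚ-pos 0<ρ m))
  drift (suc k) {m} M≤m = subst₂ (λ j r → ∣ s j - s m ∣< r) (ℕ.+-suc k m) (total m)
    (norm-cong (telescope (s (k ℕ.+ suc m)) (s (suc m)) (s m))
      (norm-+ (step M≤m) (drift k (ℕ.m≤n⇒m≤1+n M≤m))))

-- q-Pochhammer symbols

module _ {c ℓ} (M : Monoid c ℓ) where
  private module M = Monoid M
  open Algebra.Definitions.RawMonoid M.rawMonoid using () renaming (sum to fold)

  -- Folds over `Fin` unfold at the first index, whereas partial sums and products grow at the last.
  -- One induction covers both.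
  fold-last : ∀ n (f : ℕ → M.Carrier) →
    fold {suc n} (f ∘ toℕ) M.≈ fold {n} (f ∘ toℕ) M.∙ f n
  fold-last zero    f = M.trans (M.identityʳ (f 0)) (M.sym (M.identityˡ (f 0)))
  fold-last (suc n) f = M.trans (M.∙-congˡ (fold-last n (f ∘ suc)))
    (M.sym (M.assoc (f 0) (fold {n} (f ∘ suc ∘ toℕ)) (f (suc n))))

sum-last : ∀ n (f : ℕ → ℂ) → sum {suc n} (f ∘ toℕ) ≈ sum {n} (f ∘ toℕ) + f n
sum-last = fold-last +-monoid

-- Powers, the geometric series and invertibility

-- The coefficient a carries the strictness: at n = 0 a bound |z⁰| < ρ⁰ would fail. For bare powers
-- a is 1, bounded by some K with |1| < K.
norm-geometric : ∀ {a z α ρ} → ∣ a ∣< α → ∣ z ∣< ρ → ∀ n → ∣ a * z ^ n ∣< α ℚ.* ρ ^ℚ n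
norm-geometric {a} {z} {α} {ρ} a<α z<ρ zero =
  subst (∣ a * 1# ∣<_) (sym (ℚ.*-identityʳ α)) (norm-cong (identity a) a<α)
  where
  identity : ∀ a → a ≈ a * 1#
  identity = solve 1 (λ a → a := a :* con 1ℚ) ≈-refl
norm-geometric {a} {z} {α} {ρ} a<α z<ρ (suc n) =
  subst (∣ a * z ^ suc n ∣<_) (swap ρ α (ρ ^ℚ n))
    (norm-cong (identity z a (z ^ n)) (norm-* z<ρ (norm-geometric a<α z<ρ n)))
  where
  identity : ∀ z a x → z * (a * x) ≈ a * (z * x)
  identity = solve 3 (λ z a x → z :* (a :* x) := a :* (z :* x)) ≈-refl
  swap : ∀ r a x → r ℚ.* (a ℚ.* x) ≡ a ℚ.* (r ℚ.* x)
  swap = solve-∀ ℚ-ring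

-- Geometric estimates need a rational strictly above |z| and still below 1; the gap in |z| < 1
-- provides it.
record Ratio (z : ℂ) : Set where
  field
    {ρ} : ℚ
    z<ρ : ∣ z ∣< ρ
    ρ<1 : ρ ℚ.< 1ℚ
  0<ρ : 0ℚ ℚ.< ρ
  0<ρ = 0<r z<ρ

ratio : ∀ {z} → ∣ z ∣< 1ℚ → Ratio z
ratio z<1 = let η , 0<η , z<1-η = norm-shrink z<1 in record
  { z<ρ = z<1-η
  ; ρ<1 = <-by η 0<η (restore η)
  }
  where
  restore : ∀ h → (1ℚ ℚ.- h) ℚ.+ h ≡ 1ℚ
  restore = solve-∀ ℚ-ring

^⟶0 : ∀ {z} → ∣ z ∣< 1ℚ → (z ^_) ⟶ 0#
^⟶0 {z} z<1 = mk⟶ λ 0<ε →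
  let K , 1<K = norm-bounded 1#
      N , p = geometric-decay K 0<ρ ρ<1 (0<r 1<K) 0<ε
  in N , λ {n} h → norm-mono (ℚ.<⇒≤ (p h))
       (norm-cong (identity (z ^ n)) (norm-geometric 1<K z<ρ n))
  where
  open Ratio (ratio z<1)
  identity : ∀ x → 1# * x ≈ x - 0#
  identity = solve 1 (λ x → con 1ℚ :* x := x :- con 0ℚ) ≈-refl

-- The inverse is the sum of the geometric series: the finite identity `closed` passes to the limit
-- because zⁿ tends to 0.
1-z-invertible : ∀ {z} → ∣ z ∣< 1ℚ → IsInvertible (1# - z)
1-z-invertible {z} z<1 = inverse , ≈-trans (comm inverse (1# - z)) inverseʳ , inverseʳ
  where
  open Ratio (ratio z<1)
  geometric : ℕ → ℂ
  geometric zero    = 0#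
  geometric (suc n) = geometric n + z ^ n
  closed : ∀ n → 1# - z ^ n ≈ (1# - z) * geometric n
  closed zero    = solve 1 (λ z → con 1ℚ :- con 1ℚ := (con 1ℚ :- z) :* con 0ℚ) ≈-refl z
  closed (suc n) = begin
    1# - z * z ^ n                                 ≈⟨ split z (z ^ n) ⟩
    (1# - z ^ n) + (1# - z) * z ^ n                ≈⟨ +-cong (closed n) ≈-refl ⟩
    (1# - z) * geometric n + (1# - z) * z ^ n      ≈⟨ join z (geometric n) (z ^ n) ⟩
    (1# - z) * (geometric n + z ^ n)               ∎
    where
    open ≈-Reasoning
    split : ∀ z x → 1# - z * x ≈ (1# - x) + (1# - z) * x
    split = solve 2 (λ z x → con 1ℚ :- z :* x := (con 1ℚ :- x) :+ (con 1ℚ :- z) :* x) ≈-refl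
    join : ∀ z g x → (1# - z) * g + (1# - z) * x ≈ (1# - z) * (g + x)
    join = solve 3 (λ z g x →
      (con 1ℚ :- z) :* g :+ (con 1ℚ :- z) :* x := (con 1ℚ :- z) :* (g :+ x)) ≈-refl
  convergent : Convergent geometric
  convergent =
    let K , 1<K = norm-bounded 1#
    in geometric-convergent 0 0<ρ ρ<1 (0<r 1<K) λ {n} _ →
      norm-cong (identity (geometric n) (z ^ n)) (norm-geometric 1<K z<ρ n)
    where
    identity : ∀ g x → 1# * x ≈ (g + x) - g
    identity = solve 2 (λ g x → con 1ℚ :* x := (g :+ x) :- g) ≈-refl
  inverse : ℂ
  inverse = lim convergent
  inverseʳ : (1# - z) * inverse ≈ 1#
  inverseʳ = ≈-trans
    (⟶-unique (⟶-* (⟶-const (1# - z)) (to-lim convergent))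
              (⟶-cong closed (⟶-+ (⟶-const 1#) (⟶-neg (^⟶0 z<1)))))
    (solve 0 (con 1ℚ :- con 0ℚ := con 1ℚ) ≈-refl)
  comm : ∀ z w → z * w ≈ w * z
  comm = solve 2 (λ z w → z :* w := w :* z) ≈-refl

invertible-cong : ∀ {z w} → z ≈ w → IsInvertible z → IsInvertible w
invertible-cong z≈w (x , xz≈1 , zx≈1) =
    x
  , ≈-trans (*-cong ≈-refl (≈-sym z≈w)) xz≈1
  , ≈-trans (*-cong (≈-sym z≈w) ≈-refl) zx≈1

invertible-* : ∀ {z w} → IsInvertible z → IsInvertible w → IsInvertible (z * w)
invertible-* {z} {w} (x , xz≈1 , zx≈1) (y , yw≈1 , wy≈1) =
    x * y
  , ≈-trans (regroup x y z w) (≈-trans (*-cong xz≈1 yw≈1) 1*1≈1)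
  , ≈-trans (regroup z w x y) (≈-trans (*-cong zx≈1 wy≈1) 1*1≈1)
  where
  regroup : ∀ x y z w → x * y * (z * w) ≈ x * z * (y * w)
  regroup = solve 4 (λ x y z w → x :* y :* (z :* w) := x :* z :* (y :* w)) ≈-refl
  1*1≈1 : 1# * 1# ≈ 1#
  1*1≈1 = solve 0 (con 1ℚ :* con 1ℚ := con 1ℚ) ≈-refl

-- Finite and infinite q-Pochhammer products

qPoch-cong : ∀ {a b} Q n → a ≈ b → qPoch a Q n ≈ qPoch b Q n
qPoch-cong Q n a≈b = product-cong {n} λ j → +-cong ≈-refl (-‿cong (*-cong a≈b ≈-refl))

qPoch-first : ∀ a Q n → qPoch a Q (suc n) ≈ (1# - a) * qPoch (a * Q) Q n
qPoch-first a Q n = *-cong (first a) (product-cong {n} λ j → rest a Q (Q ^ toℕ j))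
  where
  first : ∀ a → 1# - a * 1# ≈ 1# - a
  first = solve 1 (λ a → con 1ℚ :- a :* con 1ℚ := con 1ℚ :- a) ≈-refl
  rest : ∀ a q x → 1# - a * (q * x) ≈ 1# - a * q * x
  rest = solve 3 (λ a q x → con 1ℚ :- a :* (q :* x) := con 1ℚ :- a :* q :* x) ≈-refl

qPoch-last : ∀ a Q n → qPoch a Q (suc n) ≈ qPoch a Q n * (1# - a * Q ^ n)
qPoch-last a Q n = fold-last *-monoid n (λ j → 1# - a * Q ^ j)

module InfiniteProduct {Q : ℂ} (Q<1 : ∣ Q ∣< 1ℚ) where
  open Ratio (ratio Q<1)

  private
    quotient = divide (p<q⇒0<q-p ρ<1) (+-pos (ℚ.positive⁻¹ 1ℚ) (ℚ.positive⁻¹ 1ℚ))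

  -- c = 2/(1 - ρ) makes cα = cαρ + 2α, which drives the induction in qPoch-near-1.
  c : ℚ
  c = proj₁ quotient

  0<c : 0ℚ ℚ.< c
  0<c = proj₁ (proj₂ quotient)

  -- cα bounds the distance of the products from 1. Below 1 it makes the quadratic error term in
  -- `qPoch-near-1` harmless and leaves room to invert the limit.
  Small : ℚ → Set
  Small α = c ℚ.* α ℚ.< 1ℚ

  -- With p = (aQ;Q)ₙ one has (1 - a)p - 1 = (p - 1) - a(p - 1) - a, and by induction |p - 1| < cαρ
  -- < 1, so the three bounds add up to at most cαρ + 2α. Splitting off the first factor rather than
  -- the last is what improves α to αρ.
  qPoch-near-1 : ∀ n {a α} → ∣ a ∣< α → Small α → ∣ qPoch a Q n - 1# ∣< c ℚ.* α
  qPoch-near-1 zero    a<α small = ≈⇒norm ≈-refl (*-pos 0<c (0<r a<α))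
  qPoch-near-1 (suc n) {a} {α} a<α small = norm-mono bound
    (norm-cong
      (≈-trans (expand a (qPoch (a * Q) Q n))
               (+-cong (≈-sym (qPoch-first a Q n)) ≈-refl))
      (norm-+ (norm-+ rest (norm-neg (norm-* a<α rest))) (norm-neg a<α)))
    where
    0<α : 0ℚ ℚ.< α
    0<α = 0<r a<α
    small′ : Small (α ℚ.* ρ)
    small′ = begin-strict
      c ℚ.* (α ℚ.* ρ)   ≡⟨ ℚ.*-assoc c α ρ ⟨
      c ℚ.* α ℚ.* ρ     ≤⟨ *-monoʳ-≤ ρ (ℚ.<⇒≤ 0<ρ) (ℚ.<⇒≤ small) ⟩
      1ℚ ℚ.* ρ          ≡⟨ ℚ.*-identityˡ ρ ⟩
      ρ                 <⟨ ρ<1 ⟩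
      1ℚ                ∎
      where open ℚ.≤-Reasoning
    rest : ∣ qPoch (a * Q) Q n - 1# ∣< c ℚ.* (α ℚ.* ρ)
    rest = qPoch-near-1 n (norm-* a<α z<ρ) small′
    expand : ∀ a p → ((p - 1#) + - (a * (p - 1#))) + - a ≈ (1# - a) * p - 1#
    expand = solve 2 (λ a p → ((p :- con 1ℚ) :+ :- (a :* (p :- con 1ℚ))) :+ :- a
                              := (con 1ℚ :- a) :* p :- con 1ℚ) ≈-refl
    bound : c ℚ.* (α ℚ.* ρ) ℚ.+ α ℚ.* (c ℚ.* (α ℚ.* ρ)) ℚ.+ α ℚ.≤ c ℚ.* α
    bound = begin
      c ℚ.* (α ℚ.* ρ) ℚ.+ α ℚ.* (c ℚ.* (α ℚ.* ρ)) ℚ.+ α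
        ≤⟨ ℚ.+-monoˡ-≤ α (ℚ.+-monoʳ-≤ (c ℚ.* (α ℚ.* ρ))
             (*-monoˡ-≤ α (ℚ.<⇒≤ 0<α) (ℚ.<⇒≤ small′))) ⟩
      c ℚ.* (α ℚ.* ρ) ℚ.+ α ℚ.* 1ℚ ℚ.+ α
        ≡⟨ double c α ρ ⟩
      c ℚ.* (α ℚ.* ρ) ℚ.+ α ℚ.* (1ℚ ℚ.+ 1ℚ)
        ≡⟨ cong (λ d → c ℚ.* (α ℚ.* ρ) ℚ.+ α ℚ.* d) (proj₂ (proj₂ quotient)) ⟨
      c ℚ.* (α ℚ.* ρ) ℚ.+ α ℚ.* ((1ℚ ℚ.- ρ) ℚ.* c)
        ≡⟨ simplify c α ρ ⟩
      c ℚ.* α ∎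
      where
      open ℚ.≤-Reasoning
      double : ∀ c α ρ → c ℚ.* (α ℚ.* ρ) ℚ.+ α ℚ.* 1ℚ ℚ.+ α
                         ≡ c ℚ.* (α ℚ.* ρ) ℚ.+ α ℚ.* (1ℚ ℚ.+ 1ℚ)
      double = solve-∀ ℚ-ring
      simplify : ∀ c α ρ → c ℚ.* (α ℚ.* ρ) ℚ.+ α ℚ.* ((1ℚ ℚ.- ρ) ℚ.* c) ≡ c ℚ.* α
      simplify = solve-∀ ℚ-ring

  -- (a;Q)_∞ reduces to (aQⁿ;Q)_∞, whose argument is small for large n.
  descent : ∀ {P : ℂ → Set} →
    (∀ {a α} → ∣ a ∣< α → Small α → P a) →
    (∀ {a} → P (a * Q) → P a) →
    ∀ a → P a
  descent {P} base step a =
    let α , a<α = norm-bounded a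
        N , small = geometric-decay (c ℚ.* α) 0<ρ ρ<1 (*-pos 0<c (0<r a<α)) (ℚ.positive⁻¹ 1ℚ)
    in go N a<α (small ℕ.≤-refl)
    where
    go : ∀ n {a α} → ∣ a ∣< α → c ℚ.* α ℚ.* ρ ^ℚ n ℚ.< 1ℚ → P a
    go zero    {α = α} a<α small = base a<α (subst (ℚ._< 1ℚ) (ℚ.*-identityʳ _) small)
    go (suc n) {α = α} a<α small = step (go n (norm-* a<α z<ρ)
      (subst (ℚ._< 1ℚ) (shift c ρ α (ρ ^ℚ n)) small))
      where
      shift : ∀ c r a x → c ℚ.* a ℚ.* (r ℚ.* x) ≡ c ℚ.* (a ℚ.* r) ℚ.* x
      shift = solve-∀ ℚ-ring

  qPoch∞ : ∀ a → QPoch∞ a Q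
  qPoch∞ = descent base step
    where
    base : ∀ {a α} → ∣ a ∣< α → Small α → QPoch∞ a Q
    base {a} {α} a<α small =
      let K , 1<K = norm-bounded 1#
          bound : ∀ n → ∣ qPoch a Q n ∣< c ℚ.* α ℚ.+ K
          bound n = norm-cong (restore (qPoch a Q n)) (norm-+ (qPoch-near-1 n a<α small) 1<K)
      -- The next factor changes (a;Q)ₙ by -(a;Q)ₙ aQⁿ, and `bound` controls (a;Q)ₙ uniformly in n.
      in geometric-convergent 0 0<ρ ρ<1 (*-pos (0<r (bound 0)) (0<r a<α)) λ {n} _ →
        subst (∣ qPoch a Q (suc n) - qPoch a Q n ∣<_) (sym (ℚ.*-assoc (c ℚ.* α ℚ.+ K) α (ρ ^ℚ n)))
          (norm-cong
            (≈-trans (difference (qPoch a Q n) (a * Q ^ n))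
                     (+-cong (≈-sym (qPoch-last a Q n)) ≈-refl))
            (norm-neg (norm-* (bound n) (norm-geometric a<α z<ρ n))))
      where
      restore : ∀ p → (p - 1#) + 1# ≈ p
      restore = solve 1 (λ p → (p :- con 1ℚ) :+ con 1ℚ := p) ≈-refl
      difference : ∀ p e → - (p * e) ≈ p * (1# - e) - p
      difference = solve 2 (λ p e → :- (p :* e) := p :* (con 1ℚ :- e) :- p) ≈-refl
    step : ∀ {a} → QPoch∞ (a * Q) Q → QPoch∞ a Q
    step {a} (converges l s⟶l) = converges ((1# - a) * l)
      (⟶-unsuc (⟶-cong (λ n → ≈-sym (qPoch-first a Q n)) (⟶-* (⟶-const (1# - a)) s⟶l)))

  qPoch∞-first : ∀ {a l m} → qPoch a Q ⟶ l → qPoch (a * Q) Q ⟶ m → l ≈ (1# - a) * m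
  qPoch∞-first {a} p q = ⟶-unique (⟶-cong (qPoch-first a Q) (⟶-suc p)) (⟶-* (⟶-const (1# - a)) q)

  qPoch∞-near-1 : ∀ {a α l ε} → ∣ a ∣< α → Small α → qPoch a Q ⟶ l → 0ℚ ℚ.< ε →
    ∣ l - 1# ∣< c ℚ.* α ℚ.+ ε
  qPoch∞-near-1 a<α small p 0<ε =
    ⟶-norm (⟶-+ p (⟶-const (- 1#))) (λ n → qPoch-near-1 n a<α small) 0<ε

  -- For large n the parameter aQⁿ is small enough for `qPoch∞-near-1`, with a bound that decays
  -- like ρⁿ. The `l n` are arbitrary limits, since the tails come from a given witness.
  qPoch∞⟶1 : ∀ {a} {l : ℕ → ℂ} → (∀ n → qPoch (a * Q ^ n) Q ⟶ l n) → l ⟶ 1#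
  qPoch∞⟶1 {a} {l} p = mk⟶ λ {ε} 0<ε →
    let α , a<α = norm-bounded a
        0<α = 0<r a<α
        δ , 0<δ , δ+δ≡ε = halve 0<ε
        N , close = geometric-decay (c ℚ.* α) 0<ρ ρ<1 (*-pos 0<c 0<α) 0<δ
        M , small = geometric-decay (c ℚ.* α) 0<ρ ρ<1 (*-pos 0<c 0<α) (ℚ.positive⁻¹ 1ℚ)
    in M ℕ.⊔ N , λ {n} h → norm-mono
      (subst (c ℚ.* (α ℚ.* ρ ^ℚ n) ℚ.+ δ ℚ.≤_) δ+δ≡ε (ℚ.+-monoˡ-≤ δ
        (subst (ℚ._≤ δ) (ℚ.*-assoc c α (ρ ^ℚ n)) (ℚ.<⇒≤ (close (ℕ.m⊔n≤o⇒n≤o M N h))))))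
      (qPoch∞-near-1 (norm-geometric a<α z<ρ n)
        (subst (ℚ._< 1ℚ) (ℚ.*-assoc c α (ρ ^ℚ n)) (small (ℕ.m⊔n≤o⇒m≤o M N h)))
        (p n) 0<δ)

  qPoch∞-invertible : ∀ {a l} → ∣ a ∣< 1ℚ → qPoch a Q ⟶ l → IsInvertible l
  qPoch∞-invertible {a} a<1 p = descent base step a a<1 p
    where
    -- The motive ranges over every limit, because the step takes its own limit of the shifted
    -- product; |a| < 1 makes each split-off factor 1 - a invertible and is inherited by aQ.
    Inv : ℂ → Set
    Inv a = ∣ a ∣< 1ℚ → ∀ {l} → qPoch a Q ⟶ l → IsInvertible l
    base : ∀ {a α} → ∣ a ∣< α → Small α → Inv a
    base {α = α} a<α small _ {l} p = invertible-cong (double-negation l)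
      (1-z-invertible (norm-cong (flip l) (norm-neg
        -- The slack is taken to be 1 - cα, so the bound on |l - 1| becomes exactly 1.
        (subst (∣ l - 1# ∣<_) (restore (c ℚ.* α)) (qPoch∞-near-1 a<α small p (p<q⇒0<q-p small))))))
      where
      flip : ∀ l → - (l - 1#) ≈ 1# - l
      flip = solve 1 (λ l → :- (l :- con 1ℚ) := con 1ℚ :- l) ≈-refl
      double-negation : ∀ l → 1# - (1# - l) ≈ l
      double-negation = solve 1 (λ l → con 1ℚ :- (con 1ℚ :- l) := l) ≈-refl
      restore : ∀ x → x ℚ.+ (1ℚ ℚ.- x) ≡ 1ℚ
      restore = solve-∀ ℚ-ring
    step : ∀ {a} → Inv (a * Q) → Inv a
    step {a} inv a<1 p =
      let converges m q = qPoch∞ (a * Q)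
      in invertible-cong (≈-sym (qPoch∞-first p q))
           (invertible-* (1-z-invertible a<1) (inv (norm-* a<1 Q<1) q))

-- The functional equation

module Telescoping (q : ℂ) (q<1 : ∣ q ∣< 1ℚ) where

  Q : ℂ
  Q = q ^ 2

  Q<1 : ∣ Q ∣< 1ℚ
  Q<1 = norm-cong (square q) (norm-* q<1 q<1)
    where
    square : ∀ q → q * q ≈ q ^ 2
    square = solve 1 (λ q → q :* q := q :^ 2) ≈-refl

  open InfiniteProduct Q<1
  open Ratio (ratio Q<1)

  ^-even : ∀ n m → q ^ (2 ℕ.* n ℕ.+ m) ≈ Q ^ n * q ^ m
  ^-even n m = ≈-trans (^-homo-* q (2 ℕ.* n) m) (*-cong (≈-sym (^-assocʳ q 2 n)) ≈-refl)

  P : ℕ → ℂ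
  P = qPoch (- q) Q

  P-suc : ∀ n → P (suc n) ≈ P n * (1# + q * Q ^ n)
  P-suc n = ≈-trans (qPoch-last (- q) Q n) (*-cong ≈-refl (signs q (Q ^ n)))
    where
    signs : ∀ q x → 1# - - q * x ≈ 1# + q * x
    signs = solve 2 (λ q x → con 1ℚ :- :- q :* x := con 1ℚ :+ q :* x) ≈-refl

  -- The tails and A are parameters, so that the results apply to the limits in any witnesses, not
  -- only to those constructed here.
  module _ (tails : Tails q) {A : ℂ} (P⟶A : P ⟶ A) where

    T u f S : ℕ → ℂ
    T n = lim (tails n)
    u n = P n * T n
    f   = F-summand q tails
    S n = sum {n} (f ∘ toℕ)

    -- Writes the parameter -q²ⁿ⁺² as aQⁿ with a = -Q, the shape that `qPoch∞⟶1` and `qPoch∞-first`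
    -- expect.
    T-limit : ∀ n → qPoch (- Q * Q ^ n) Q ⟶ T n
    T-limit n = ⟶-cong
      (λ k → qPoch-cong Q k (≈-trans (-‿cong (^-even n 2)) (flip (Q ^ n) Q)))
      (to-lim (tails n))
      where
      flip : ∀ x y → - (x * y) ≈ - y * x
      flip = solve 2 (λ x y → :- (x :* y) := :- y :* x) ≈-refl

    T-suc : ∀ n → T n ≈ (1# + Q * Q ^ n) * T (suc n)
    T-suc n = ≈-trans
      (qPoch∞-first (T-limit n)
        (⟶-cong (λ k → qPoch-cong Q k (shift Q (Q ^ n))) (T-limit (suc n))))
      (*-cong (signs Q (Q ^ n)) ≈-refl)
      where
      shift : ∀ q x → - q * (q * x) ≈ - q * x * q
      shift = solve 2 (λ q x → :- q :* (q :* x) := :- q :* x :* q) ≈-refl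
      signs : ∀ q x → 1# - - q * x ≈ 1# + q * x
      signs = solve 2 (λ q x → con 1ℚ :- :- q :* x := con 1ℚ :+ q :* x) ≈-refl

    u-limit : u ⟶ A * 1#
    u-limit = ⟶-* P⟶A (qPoch∞⟶1 T-limit)

    f≈qQⁿu : ∀ n → f n ≈ q * Q ^ n * u n
    f≈qQⁿu n = ≈-trans (*-cong (*-cong (^-even n 1) ≈-refl) ≈-refl) (regroup q (Q ^ n) (P n) (T n))
      where
      regroup : ∀ q x p t → x * (q * 1#) * p * t ≈ q * x * (p * t)
      regroup = solve 4 (λ q x p t → x :* (q :* con 1ℚ) :* p :* t := q :* x :* (p :* t)) ≈-refl

    -- Since u converges it is eventually bounded, and f n = qQⁿ u n is then dominated by a
    -- geometric series from that index on.
    summable : Summable f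
    summable =
      let K , N , u<K = ⟶-bounded u-limit
      in geometric-convergent N 0<ρ ρ<1 (0<r (u<K ℕ.≤-refl)) λ {n} h →
        subst (∣ S (suc n) - S n ∣<_) (swap (ρ ^ℚ n) K)
          (norm-cong
            (≈-trans (≈-sym (f≈qQⁿu n)) (≈-trans (difference (S n) (f n))
              (+-cong (≈-sym (sum-last n f)) ≈-refl)))
            (norm-* (norm-geometric q<1 z<ρ n) (u<K h)))
      where
      swap : ∀ x k → 1ℚ ℚ.* x ℚ.* k ≡ k ℚ.* x
      swap = solve-∀ ℚ-ring
      difference : ∀ s a → a ≈ (s + a) - s
      difference = solve 2 (λ s a → a := (s :+ a) :- s) ≈-refl

    -- Once all terms are expressed through Pₙ and Tₙ₊₁ this is a polynomial identity. The grouping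
    -- is the one that turns -q u n into -q u (n + 1) in the induction for `S-suc`.
    f-suc : ∀ n → f (suc n) - q * u n ≈ q * f n - q * u (suc n)
    f-suc n = begin
      f (suc n) - q * u n
        ≈⟨ +-cong (≈-trans (f≈qQⁿu (suc n)) (*-cong ≈-refl usuc))
                  (-‿cong (*-cong ≈-refl un)) ⟩
      q * (Q * x) * (p * (1# + q * x) * t) - q * (p * ((1# + Q * x) * t))
        ≈⟨ identity q x p t ⟩
      q * (q * x * (p * ((1# + Q * x) * t))) - q * (p * (1# + q * x) * t)
        ≈⟨ +-cong (*-cong ≈-refl (≈-trans (f≈qQⁿu n) (*-cong ≈-refl un)))
                  (-‿cong (*-cong ≈-refl usuc)) ⟨
      q * f n - q * u (suc n) ∎
      where
      open ≈-Reasoning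
      x p t : ℂ
      x = Q ^ n
      p = P n
      t = T (suc n)
      un : u n ≈ p * ((1# + Q * x) * t)
      un = *-cong ≈-refl (T-suc n)
      usuc : u (suc n) ≈ p * (1# + q * x) * t
      usuc = *-cong (P-suc n) ≈-refl
      identity : ∀ q x p t →
        q * (q ^ 2 * x) * (p * (1# + q * x) * t) - q * (p * ((1# + q ^ 2 * x) * t))
        ≈ q * (q * x * (p * ((1# + q ^ 2 * x) * t))) - q * (p * (1# + q * x) * t)
      identity = solve 4 (λ q x p t →
        q :* (q :^ 2 :* x) :* (p :* (con 1ℚ :+ q :* x) :* t)
          :- q :* (p :* ((con 1ℚ :+ q :^ 2 :* x) :* t))
        := q :* (q :* x :* (p :* ((con 1ℚ :+ q :^ 2 :* x) :* t)))
          :- q :* (p :* (con 1ℚ :+ q :* x) :* t)) ≈-refl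

    S-suc : ∀ n → S (suc n) ≈ q * S n + 2# * (q * T 0) - q * u n
    -- The constant 2 originates here: S 1 = f 0 = q T 0, and u 0 = T 0, so one q T 0 is the initial
    -- term and the other offsets -q u 0.
    S-suc zero    = identity q (T 0)
      where
      identity : ∀ q t → q * 1# * 1# * t + 0# ≈ q * 0# + (1# + 1#) * (q * t) - q * (1# * t)
      identity = solve 2 (λ q t → q :* con 1ℚ :* con 1ℚ :* t :+ con 0ℚ
        := q :* con 0ℚ :+ (con 1ℚ :+ con 1ℚ) :* (q :* t) :- q :* (con 1ℚ :* t)) ≈-refl
    S-suc (suc n) = begin
      S (2 ℕ.+ n)
        ≈⟨ sum-last (suc n) f ⟩
      S (suc n) + f (suc n)
        ≈⟨ +-cong (S-suc n) ≈-refl ⟩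
      (q * S n + 2# * (q * T 0) - q * u n) + f (suc n)
        ≈⟨ swap (q * S n + 2# * (q * T 0)) (q * u n) (f (suc n)) ⟩
      (q * S n + 2# * (q * T 0)) + (f (suc n) - q * u n)
        ≈⟨ +-cong ≈-refl (f-suc n) ⟩
      (q * S n + 2# * (q * T 0)) + (q * f n - q * u (suc n))
        ≈⟨ collect q (S n) (2# * (q * T 0)) (f n) (q * u (suc n)) ⟩
      q * (S n + f n) + 2# * (q * T 0) - q * u (suc n)
        ≈⟨ +-cong (+-cong (*-cong ≈-refl (sum-last n f)) ≈-refl) ≈-refl ⟨
      q * S (suc n) + 2# * (q * T 0) - q * u (suc n) ∎
      where
      open ≈-Reasoning
      swap : ∀ a b c → (a - b) + c ≈ a + (c - b)
      swap = solve 3 (λ a b c → (a :- b) :+ c := a :+ (c :- b)) ≈-refl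
      collect : ∀ q s b f v → (q * s + b) + (q * f - v) ≈ q * (s + f) + b - v
      collect = solve 5 (λ q s b f v →
        (q :* s :+ b) :+ (q :* f :- v) := q :* (s :+ f) :+ b :- v) ≈-refl

    F-functional-equation : ∀ {F B} → S ⟶ F → qPoch (- Q) Q ⟶ B →
      (1# - q) * F ≈ q * (2# * B - A)
    F-functional-equation {F} {B} S⟶F p = begin
      (1# - q) * F                            ≈⟨ expand q F ⟩
      F - q * F                               ≈⟨ +-cong limit ≈-refl ⟩
      q * F + 2# * (q * T 0) - q * (A * 1#) - q * F
        ≈⟨ collect q F (T 0) A ⟩
      q * (2# * T 0 - A)
        -- `T 0` and B are limits of the same product, since the exponent 2·0 + 2 computes to 2.
        ≈⟨ *-cong ≈-refl (+-cong (*-cong ≈-refl (⟶-unique (to-lim (tails 0)) p)) ≈-refl) ⟩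
      q * (2# * B - A)                       ∎
      where
      open ≈-Reasoning
      limit : F ≈ q * F + 2# * (q * T 0) - q * (A * 1#)
      -- The shifted partial sums tend to F, and by the recursion also to the right-hand side.
      limit = ⟶-unique (⟶-suc S⟶F) (⟶-cong (λ n → ≈-sym (S-suc n))
        (⟶-+ (⟶-+ (⟶-* (⟶-const q) S⟶F) (⟶-const (2# * (q * T 0))))
             (⟶-neg (⟶-* (⟶-const q) u-limit))))
      expand : ∀ q f → (1# - q) * f ≈ f - q * f
      expand = solve 2 (λ q f → (con 1ℚ :- q) :* f := f :- q :* f) ≈-refl
      collect : ∀ q f b a →
        q * f + (1# + 1#) * (q * b) - q * (a * 1#) - q * f ≈ q * ((1# + 1#) * b - a)
      collect = solve 4 (λ q f b a →
        q :* f :+ (con 1ℚ :+ con 1ℚ) :* (q :* b) :- q :* (a :* con 1ℚ) :- q :* f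
        := q :* ((con 1ℚ :+ con 1ℚ) :* b :- a)) ≈-refl

-- Existence of both sides and their equality

theorem1p1 : (q : ℂ) → ∣ q ∣< 1ℚ →
    FConverges q × ClosedFormDefined q ×
    ((c : FConverges q) (d : ClosedFormDefined q) → F-ed-od q c ≈ closedForm q d)
theorem1p1 q q<1 = F-converges , closed-defined , equal
  where
  open Telescoping q q<1
  open InfiniteProduct Q<1
  tails : Tails q
  tails n = qPoch∞ (- (q ^ (2 ℕ.* n ℕ.+ 2)))
  F-converges : FConverges q
  F-converges = record { tails = tails ; series = summable tails (to-lim (qPoch∞ (- q))) }
  closed-defined : ClosedFormDefined q
  closed-defined = record
    { -q⨾q²∞      = qPoch∞ (- q)
    ; -q²⨾q²∞     = qPoch∞ (- Q)
    ; 1-q-inv     = 1-z-invertible q<1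
    ; -q²⨾q²∞-inv = qPoch∞-invertible (norm-neg Q<1) (to-lim (qPoch∞ (- Q)))
    }
  equal : (c : FConverges q) (d : ClosedFormDefined q) → F-ed-od q c ≈ closedForm q d
  equal c d = begin
    F                                    ≈⟨ *-identity F ⟨
    1# * F                               ≈⟨ *-cong inverseˡ ≈-refl ⟨
    q′ * (1# - q) * F                    ≈⟨ regroup q′ (1# - q) F ⟩
    q′ * ((1# - q) * F)
      ≈⟨ *-cong ≈-refl (F-functional-equation (FConverges.tails c) (to-lim -q⨾q²∞)
           (to-lim (FConverges.series c)) (to-lim -q²⨾q²∞)) ⟩
    q′ * (q * (2# * B - A′))             ≈⟨ distribute q q′ A′ B ⟩
    -- Replacing 1 by B B′ gives the term in A′ a factor B, which can then be taken out of the
    -- bracket.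
    q * q′ * (2# * B) - q * q′ * A′ * 1# ≈⟨ +-cong ≈-refl (-‿cong (*-cong ≈-refl B-inverseʳ)) ⟨
    q * q′ * (2# * B) - q * q′ * A′ * (B * B′)
                                         ≈⟨ factor q q′ A′ B B′ ⟩
    q * B * q′ * (2# - A′ * B′)          ∎
    where
    open ≈-Reasoning
    open ClosedFormDefined d
    F q′ A′ B B′ : ℂ
    F  = F-ed-od q c
    q′ = proj₁ 1-q-inv
    A′ = lim -q⨾q²∞
    B  = lim -q²⨾q²∞
    B′ = proj₁ -q²⨾q²∞-inv
    inverseˡ : q′ * (1# - q) ≈ 1#
    inverseˡ = proj₁ (proj₂ 1-q-inv)
    B-inverseʳ : B * B′ ≈ 1#
    B-inverseʳ = proj₂ (proj₂ -q²⨾q²∞-inv)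
    *-identity : ∀ f → 1# * f ≈ f
    *-identity = solve 1 (λ f → con 1ℚ :* f := f) ≈-refl
    regroup : ∀ a b c → a * b * c ≈ a * (b * c)
    regroup = solve 3 (λ a b c → a :* b :* c := a :* (b :* c)) ≈-refl
    distribute : ∀ q r a b →
      r * (q * ((1# + 1#) * b - a)) ≈ q * r * ((1# + 1#) * b) - q * r * a * 1#
    distribute = solve 4 (λ q r a b → r :* (q :* ((con 1ℚ :+ con 1ℚ) :* b :- a))
      := q :* r :* ((con 1ℚ :+ con 1ℚ) :* b) :- q :* r :* a :* con 1ℚ) ≈-refl
    factor : ∀ q r a b c →
      q * r * ((1# + 1#) * b) - q * r * a * (b * c) ≈ q * b * r * ((1# + 1#) - a * c)
    factor = solve 5 (λ q r a b c →
      q :* r :* ((con 1ℚ :+ con 1ℚ) :* b) :- q :* r :* a :* (b :* c)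
      := q :* b :* r :* ((con 1ℚ :+ con 1ℚ) :- a :* c)) ≈-refl
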